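{- Let $m\in\mathbb{N}$ and $A\subseteq\mathbb{N}^m$. The following two statements are equivalent. (1) There exist functions $\alpha_1,\ldots,\alpha_m:\mathcal{P}_f(\mathbb{N}^{\mathbb{N}})\to\mathbb{N}$ and $H_1,\ldots,H_m:\mathcal{P}_f(\mathbb{N}^{\mathbb{N}})\to\mathcal{P}_f(\mathbb{N})$ such that (a) if $F,G\in\mathcal{P}_f(\mathbb{N}^{\mathbb{N}})$ and $F\subsetneq G$, then for every $i\in\{1,\ldots,m\}$, $\max H_i(F)<\min H_i(G)$; and (b) whenever $(G_i)_{i\in\mathbb{N}}$ is a sequence in $\mathcal{P}_f(\mathbb{N}^{\mathbb{N}})$ with $G_1\subsetneq G_2\subsetneq\cdots\subsetneq G_n\subsetneq\cdots$, then for all $\beta_1<\cdots<\beta_m$ in $\mathcal{P}_f(\mathbb{N})$ and all choices of $f_i\in G_i$ ($i\in\mathbb{N}$), one has $$\left(\sum_{i\in\beta_1}\Bigl(\alpha_1(G_i)+\sum_{t\in H_1(G_i)}f_i(t)\Bigr),\ldots,\sum_{i\in\beta_m}\Bigl(\alpha_m(G_i)+\sum_{t\in H_m(G_i)}f_i(t)\Bigr)\right)\in A.$$ (2) There exist idempotents $p_1,\ldots,p_m$ in $(\mathcal{J},+)$ such that $A\in\bigotimes_{i=1}^m p_i$.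
   Context: $\mathbb{N}$ is the set of positive integers; $\mathcal{P}_f(X)$ is the set of nonempty finite subsets of $X$; $\mathbb{N}^{\mathbb{N}}$ is the set of all functions $\mathbb{N}\to\mathbb{N}$. For $\beta,\gamma\in\mathcal{P}_f(\mathbb{N})$, $\beta<\gamma$ means $\max\beta<\min\gamma$. $\beta\mathbb{N}$ is the set of ultrafilters on $\mathbb{N}$, with the operation: $A\in p+q$ iff $\{x\in\mathbb{N}:-x+A\in q\}\in p$, where $-x+A=\{y\in\mathbb{N}:x+y\in A\}$. An ultrafilter $p$ is idempotent if $p+p=p$. A set $A\subseteq\mathbb{N}$ is a $J$-set if for every $F\in\mathcal{P}_f(\mathbb{N}^{\mathbb{N}})$ there exist $a\in\mathbb{N}$ and $\beta\in\mathcal{P}_f(\mathbb{N})$ such that $a+\sum_{t\in\beta}f(t)\in A$ for all $f\in F$. $\mathcal{J}=\{p\in\beta\mathbb{N}:\text{every }A\in p\text{ is a }J\text{ -set}\}$; it is a two-sided ideal of $(\beta\mathbb{N},+)$. Tensor products: for ultrafilters $p_1,\ldots,p_k$ on $\mathbb{N}$, $\bigotimes_{i=1}^k p_i$ is the ultrafilter on $\mathbb{N}^k$ defined recursively by $\bigotimes_{i=1}^1p_i=p_1$, and, for $A\subseteq\mathbb{N}^{k+1}$, $A\in\bigotimes_{i=1}^{k+1}p_i$ iff $\{(x_1,\ldots,x_k)\in\mathbb{N}^k:\{x_{k+1}\in\mathbb{N}:(x_1,\ldots,x_{k+1})\in A\}\in p_{k+1}\}\in\bigotimes_{i=1}^kp_i$.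 -}

module Defs where

open import Axiom.ExcludedMiddle using (ExcludedMiddle) public
open import Data.List.Base using (filter; deduplicate)
import Data.List.Membership.Setoid as ListMembership
import Data.List.Relation.Binary.Subset.Setoid as ListSubset
open import Data.List.NonEmpty as List⁺ using (List⁺; _∷_; toList; foldr₁)
import Data.Nat.Base as ℕ
import Data.Nat.Properties as ℕ
open import Data.Product.Base using (Σ-syntax; ∃-syntax; _×_; _,_)
open import Data.Sum.Base using (_⊎_; inj₁; inj₂)
open import Data.Vec.Base using (Vec; []; _∷_; _∷ʳ_)
open import Data.Vec.Functional using (Vector; init; last)
open import Function.Base using (_∘_)
open import Function.Bundles using (Func; Surjection; _⇔_)
open import Level using (Level; _⊔_; 0ℓ) renaming (suc to lsuc)
open import Relation.Binary.Bundles using (Setoid)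
open import Relation.Binary.Definitions using (DecidableEquality)
open import Relation.Binary.PropositionalEquality
  using (_≡_; refl; cong; _→-setoid_; setoid)
open import Relation.Nullary using (¬_; yes; no)
open import Relation.Nullary.Decidable using (¬?)
open import Relation.Unary using (Pred; ∅; ∁; _∩_; _⊆_)

-- Every surjection splits.  The section is required to respect equality, so
-- this is the extensional axiom of choice, which, unlike the type-theoretic
-- one, is not provable.
AxiomOfChoice : ∀ a ℓ₁ b ℓ₂ → Set (lsuc (a ⊔ ℓ₁ ⊔ b ⊔ ℓ₂))
AxiomOfChoice a ℓ₁ b ℓ₂ =
  {S : Setoid a ℓ₁} {T : Setoid b ℓ₂} (s : Surjection S T) →
  Σ[ g ∈ Func T S ] (∀ y → Setoid._≈_ T (Surjection.to s (Func.to g y)) y)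

record ℕ⁺ : Set where
  constructor positive
  field
    value        : ℕ.ℕ
    .{{value≢0}} : ℕ.NonZero value

open ℕ⁺ public using (value)

1⁺ : ℕ⁺
1⁺ = positive 1

+-nonZero : ∀ m n .{{_ : ℕ.NonZero m}} → ℕ.NonZero (m ℕ.+ n)
+-nonZero (ℕ.suc m) n = _

infixl 6 _+_

_+_ : ℕ⁺ → ℕ⁺ → ℕ⁺
positive m + positive n = positive (m ℕ.+ n) {{+-nonZero m n}}

infix 4 _≟_

_≟_ : DecidableEquality ℕ⁺
positive m ≟ positive n with m ℕ.≟ n
... | yes refl = yes refl
... | no  m≢n  = no (m≢n ∘ cong value)

ℕ⁺-setoid : Setoid 0ℓ 0ℓ
ℕ⁺-setoid = setoid ℕ⁺

-- Functions are identified when they agree pointwise.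
ℕ^ℕ : Setoid 0ℓ 0ℓ
ℕ^ℕ = ℕ⁺ →-setoid ℕ⁺

-- A nonempty finite subset is presented by a nonempty list of its elements;
-- order and repetitions are discarded by the equality of 𝒫f-setoid.
module FiniteSubset {c ℓ} (S : Setoid c ℓ) where

  open ListMembership S using () renaming (_∈_ to _∈ˡ_)
  open Setoid S using () renaming (Carrier to X)
  open ListSubset S using () renaming (_⊆_ to _⊆ˡ_)

  infix 4 _∈_ _⊑_ _⊊_ _≋_

  𝒫f : Set c
  𝒫f = List⁺ X

  _∈_ : X → 𝒫f → Set (c ⊔ ℓ)
  x ∈ F = x ∈ˡ toList F

  _⊑_ _⊊_ _≋_ : 𝒫f → 𝒫f → Set (c ⊔ ℓ)
  F ⊑ G = toList F ⊆ˡ toList G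
  F ⊊ G = F ⊑ G × ¬ (G ⊑ F)
  F ≋ G = F ⊑ G × G ⊑ F

  𝒫f-setoid : Setoid c (c ⊔ ℓ)
  𝒫f-setoid = record
    { Carrier       = 𝒫f
    ; _≈_           = _≋_
    ; isEquivalence = record
      { refl  = (λ x∈ → x∈) , (λ x∈ → x∈)
      ; sym   = λ (F⊆G , G⊆F) → G⊆F , F⊆G
      ; trans = λ (F⊆G , G⊆F) (G⊆H , H⊆G) →
          (λ x∈ → G⊆H (F⊆G x∈)) , (λ x∈ → G⊆F (H⊆G x∈))
      }
    }

open FiniteSubset ℕ⁺-setoid public
  using () renaming (𝒫f to 𝒫fℕ; 𝒫f-setoid to 𝒫fℕ-setoid)
open FiniteSubset ℕ^ℕ public
  using (_∈_; _⊊_) renaming (𝒫f to 𝒫fℕ^ℕ; 𝒫f-setoid to 𝒫fℕ^ℕ-setoid)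

max min : 𝒫fℕ → ℕ.ℕ
max β = foldr₁ ℕ._⊔_ (List⁺.map value β)
min β = foldr₁ ℕ._⊓_ (List⁺.map value β)

infix 4 _≺_

_≺_ : 𝒫fℕ → 𝒫fℕ → Set
β ≺ γ = max β ℕ.< min γ

removeRepeats : 𝒫fℕ → 𝒫fℕ
removeRepeats (x ∷ xs) = x ∷ filter (¬? ∘ (x ≟_)) (deduplicate _≟_ xs)

-- Every element of the set β contributes exactly once, however often it is
-- listed.
∑ : 𝒫fℕ → (ℕ⁺ → ℕ⁺) → ℕ⁺
∑ β f = foldr₁ _+_ (List⁺.map f (removeRepeats β))

infix 5 ∑
syntax ∑ β (λ t → e) = ∑[ t ∈ β ] e

record Ultrafilter (X : Set) : Set₁ where
  infix 4 _∋_
  field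
    _∋_    : Pred X 0ℓ → Set
    proper : ¬ (_∋_ ∅)
    upward : ∀ {A B} → A ⊆ B → _∋_ A → _∋_ B
    meet   : ∀ {A B} → _∋_ A → _∋_ B → _∋_ (A ∩ B)
    ultra  : ∀ A → _∋_ A ⊎ _∋_ (∁ A)

open Ultrafilter public using (_∋_)

infix 4 _≈ᵤ_

_≈ᵤ_ : ∀ {X} → Ultrafilter X → Ultrafilter X → Set₁
p ≈ᵤ q = ∀ A → p ∋ A ⇔ q ∋ A

-- Along h : X → Y → Z, the sets A for which {x : {y : h x y ∈ A} ∈ q} ∈ p.
-- Both the sum and the tensor product of ultrafilters have this form.
combine : ∀ {X Y Z : Set} → (X → Y → Z) →
          Ultrafilter X → Ultrafilter Y → Ultrafilter Z
combine h p q = record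
  { _∋_    = λ A → p ∋ (λ x → q ∋ (λ y → A (h x y)))
  ; proper = λ ∅∈ → P.proper (P.upward (λ ∅∈q → Q.proper ∅∈q) ∅∈)
  ; upward = λ A⊆B → P.upward (Q.upward A⊆B)
  ; meet   = λ A∈ B∈ →
      P.upward (λ (A∈q , B∈q) → Q.meet A∈q B∈q) (P.meet A∈ B∈)
  ; ultra  = ultra
  }
  where
  module P = Ultrafilter p
  module Q = Ultrafilter q

  ultra : ∀ A → (p ∋ (λ x → q ∋ (λ y → A (h x y)))) ⊎
                (p ∋ (λ x → q ∋ (λ y → ∁ A (h x y))))
  ultra A with P.ultra (λ x → q ∋ (λ y → A (h x y)))
  ... | inj₁ A∈ = inj₁ A∈
  ... | inj₂ A∉ = inj₂ (P.upward step A∉)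
    where
    step : ∁ (λ x → q ∋ (λ y → A (h x y))) ⊆ (λ x → q ∋ (λ y → ∁ A (h x y)))
    step {x} ¬A∈q with Q.ultra (λ y → A (h x y))
    ... | inj₁ A∈q  with () ← ¬A∈q A∈q
    ... | inj₂ ∁A∈q = ∁A∈q

infixl 6 _⊕_

_⊕_ : Ultrafilter ℕ⁺ → Ultrafilter ℕ⁺ → Ultrafilter ℕ⁺
_⊕_ = combine _+_

Idempotent : Pred (Ultrafilter ℕ⁺) _
Idempotent p = p ⊕ p ≈ᵤ p

-- ℕ¹ is Vec ℕ⁺ 1, so the one-factor product is p₁ transported along x ↦ [x].
⨂ : ∀ {k} → Vector (Ultrafilter ℕ⁺) (ℕ.suc k) →
    Ultrafilter (Vec ℕ⁺ (ℕ.suc k))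
⨂ {ℕ.zero}  p = record
  { _∋_    = λ A → last p ∋ (λ x → A (x ∷ []))
  ; proper = P.proper
  ; upward = λ A⊆B → P.upward A⊆B
  ; meet   = P.meet
  ; ultra  = λ A → P.ultra (λ x → A (x ∷ []))
  }
  where module P = Ultrafilter (last p)
⨂ {ℕ.suc k} p = combine _∷ʳ_ (⨂ (init p)) (last p)

J-set : Pred (Pred ℕ⁺ 0ℓ) 0ℓ
J-set A = (F : 𝒫fℕ^ℕ) →
  ∃[ a ] ∃[ β ] (∀ {f} → f ∈ F → A (a + (∑[ t ∈ β ] f t)))

𝒥 : Pred (Ultrafilter ℕ⁺) _
𝒥 p = ∀ {A} → p ∋ A → J-set A

{-# OPTIONS --safe #-}
module Submission where

-- (1) ⇒ (2).  For each coordinate, the sums of contributions along finite chains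
-- strictly above F form J-sets D_F with x + D_G ⊆ D_F whenever x ∈ D_F is a sum
-- along a chain ending at G.  J-sets are partition regular (Hales–Jewett), so
-- the sets containing some D_F up to a non-J-set form a filter with 𝓕 ⊆ 𝓕 + 𝓕,
-- and every such filter extends to an idempotent ultrafilter, necessarily in 𝒥.
-- Concatenating chains coordinate by coordinate yields A ∈ ⨂ p.
--
-- (2) ⇒ (1).  α(F) and H(F) are chosen by recursion along ⊊ so that the new
-- contribution keeps every partial sum bounded by a number lo(F) inside the
-- starred set {x ∈ B : -x + B ∈ p} prescribed by the coordinates before it; such
-- contributions exist because the constraint lies in p and p ∈ 𝒥.

open import Defs
open import Data.Fin.Base using (Fin; suc; inject₁)
open import Data.Nat.Base using (ℕ) renaming (suc to 1+_)
open import Data.Product.Base using (Σ-syntax; _×_)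
open import Data.Vec.Base using (Vec; tabulate)
open import Data.Vec.Functional using (Vector)
open import Function.Bundles using (Func; _⇔_; _⟨$⟩_)
open import Level using (0ℓ)
open import Relation.Unary using (Pred)

open import Algebra.Properties.CommutativeSemigroup using (interchange; x∙yz≈y∙xz)
open import Data.Empty using (⊥; ⊥-elim)
open import Data.Fin.Base as Fin using (zero; fromℕ; funToFin; finToFun)
import Data.Fin.Properties as Fin
open import Data.Fin.Relation.Unary.Top using (view; ‵fromℕ; ‵inject₁)
open import Data.List.Base as List using (List; []; _∷_; allFin; filter; cartesianProductWith)
open import Data.List.Membership.Propositional using () renaming (_∈_ to _∈ˡ_)
import Data.List.Membership.Propositional.Properties as ∈ˡ
import Data.List.Membership.Setoid.Properties as ∈ₛ
open import Data.List.NonEmpty as List⁺ using (_∷_; _∷⁺_; _⁺++⁺_; toList; foldr₁)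
import Data.List.Properties as List
open import Data.List.Relation.Binary.Permutation.Propositional using (_↭_; ↭-sym; ↭⇒↭ₛ)
import Data.List.Relation.Binary.Permutation.Propositional.Properties as ↭
import Data.List.Relation.Binary.Permutation.Setoid.Properties as ↭ₛ
open import Data.List.Relation.Unary.All as All using (All; []; _∷_)
import Data.List.Relation.Unary.All.Properties as All
open import Data.List.Relation.Unary.AllPairs as AllPairs using (AllPairs; []; _∷_)
open import Data.List.Relation.Unary.Any as Any using (Any; here; there)
import Data.List.Relation.Unary.Any.Properties as Any
open import Data.List.Relation.Unary.Linked.Properties using (Linked⇒AllPairs)
open import Data.List.Relation.Unary.Unique.DecPropositional.Properties _≟_ using (deduplicate-!)
open import Data.List.Relation.Unary.Unique.Propositional using (Unique)
import Data.List.Relation.Unary.Unique.Propositional.Properties as Unique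
import Data.List.Sort as Sort
open import Data.Maybe.Base as Maybe using (Maybe; just; nothing; fromMaybe; maybe′)
import Data.Nat.Base as ℕ
import Data.Nat.DivMod as ℕ
open import Data.Nat.ListAction using (sum)
open import Data.Nat.ListAction.Properties using (sum-++; sum-↭)
import Data.Nat.Properties as ℕ
open import Data.Product.Base using (Σ; ∃; ∃-syntax; _,_; proj₁; proj₂)
open import Data.Sum.Base using (_⊎_; inj₁; inj₂; [_,_]′)
open import Data.Unit.Base using (⊤; tt)
open import Data.Vec.Base as Vec using ([]; _∷_; _∷ʳ_; _++_; lookup)
import Data.Vec.Functional as Vector
open import Data.Vec.Membership.Propositional using () renaming (_∈_ to _∈ᵛ_)
import Data.Vec.Membership.Propositional.Properties as ∈ᵛ
import Data.Vec.Properties as Vec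
open import Data.Vec.Relation.Unary.Any using (here)
import Data.Vec.Relation.Unary.Any as Anyᵛ
import Data.Vec.Relation.Unary.Any.Properties as Anyᵛ
open import Function.Base using (_∘_; id)
open import Function.Bundles using (Equivalence; Surjection; mk⇔)
open import Induction.WellFounded as WellFounded using (WellFounded; Acc; acc; acc-inverse; module FixPoint)
open import Level using (Lift; lift; _⊔_) renaming (suc to lsuc)
open import Relation.Binary.Bundles using (Poset; Setoid)
import Relation.Binary.Construct.On as On
open import Relation.Binary.Core using (Rel)
open import Relation.Binary.PropositionalEquality
  using (_≡_; _≗_; refl; sym; trans; cong; cong₂; subst; setoid; module ≡-Reasoning)
open import Relation.Nullary using (¬_; Dec; yes; no)
open import Relation.Nullary.Decidable using (True; toWitness; fromWitness; ¬?)
open import Relation.Unary using (U; ∅; ∁; _∩_; _∪_; _⊆_)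

open FiniteSubset ℕ^ℕ using (_⊑_; _≋_)

-- Zorn's lemma and filters

-- The filter of the forward direction contains the complement of every non-J-set from the start, so
-- every ultrafilter above it inherits membership in 𝒥. The condition `F ≤ᶠ F ⊕ᶠ F` makes the
-- ultrafilters above F a closed subsemigroup of βℕ; a maximal such filter is the counterpart of a
-- minimal closed subsemigroup in Ellis's lemma. The converse has to fix α(F) and H(F) without
-- knowing which families precede F in a chain or which functions are picked from them. All those
-- families are proper subsets of F, hence finite in number, so a single number bounds every sum
-- formed before F, in any coordinate. The constraint at F then ranges over all values up to that
-- number: finitely many conditions, each of them large. Finite sets are lists up to `≋`, which α
-- and H must respect. Hence the canonical forms, and the detour through sublists to reach every
-- proper subset of F.

module Classical (em : ∀ {ℓ} → ExcludedMiddle ℓ) where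

  abstract
    -- Excluded middle makes every proposition equivalent to a small one.
    Squash : ∀ {ℓ} → Set ℓ → Set
    Squash P = True (em {P = P})

    squash : ∀ {ℓ} {P : Set ℓ} → P → Squash P
    squash = fromWitness

    unsquash : ∀ {ℓ} {P : Set ℓ} → Squash P → P
    unsquash = toWitness

  dne : ∀ {ℓ} {P : Set ℓ} → ¬ ¬ P → P
  dne {P = P} ¬¬p with em {P = P}
  ... | yes p = p
  ... | no ¬p = ⊥-elim (¬¬p ¬p)

record Representatives {c ℓ} (S : Setoid c ℓ) : Set (c ⊔ ℓ) where
  open Setoid S
  field
    rep      : Carrier → Carrier
    rep-≈    : ∀ x → rep x ≈ x
    rep-cong : ∀ {x y} → x ≈ y → rep x ≡ rep y

-- The identity from the carrier under `≡` onto `S` is a surjection; a section of it that respects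
-- equality picks one normal form from each class.
representatives : (∀ {a ℓ₁ b ℓ₂} → AxiomOfChoice a ℓ₁ b ℓ₂) →
                  ∀ {c ℓ} (S : Setoid c ℓ) → Representatives S
representatives ac S = record
  { rep      = Func.to (proj₁ section)
  ; rep-≈    = proj₂ section
  ; rep-cong = Func.cong (proj₁ section)
  }
  where
  open Setoid S using (Carrier; reflexive)
  quotient : Surjection (setoid Carrier) S
  quotient = record
    { to         = id
    ; cong       = reflexive
    ; surjective = λ y → y , reflexive
    }
  section = ac quotient

-- Bourbaki–Witt: if no element were maximal, a strictly inflationary map would
-- generate a tower, closed under suprema of chains, which is itself a chain.
module Zorn (em : ∀ {ℓ} → ExcludedMiddle ℓ)
            (ac : ∀ {a ℓ₁ b ℓ₂} → AxiomOfChoice a ℓ₁ b ℓ₂)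
            {c ℓ₁ ℓ₂} (P : Poset c ℓ₁ ℓ₂) where
  open Classical em
  open Poset P renaming (trans to ≤-trans)

  Chain : Pred Carrier 0ℓ → Set _
  Chain C = ∀ {x y} → C x → C y → x ≤ y ⊎ y ≤ x

  IsSupremum : Pred Carrier 0ℓ → Carrier → Set _
  IsSupremum C u = (∀ {x} → C x → x ≤ u) × (∀ {v} → (∀ {x} → C x → x ≤ v) → u ≤ v)

  Maximal : Carrier → Set _
  Maximal x = ∀ {y} → x ≤ y → y ≤ x

  module Tower
    (⋁ : ∀ C → Chain C → ∃ (IsSupremum C))
    (next : Carrier → Carrier)
    (next-≥ : ∀ x → x ≤ next x)
    (next-≰ : ∀ x → ¬ (next x ≤ x))
    (next-mono-≈ : ∀ {x y} → x ≤ y → y ≤ x → next x ≤ next y)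
    where

    -- The least tower. The supremum of the empty chain is its starting point.
    data T : Carrier → Set (c ⊔ ℓ₂ ⊔ lsuc 0ℓ) where
      step : ∀ {x} → T x → T (next x)
      sup  : ∀ C (ch : Chain C) → (∀ {x} → C x → T x) → T (proj₁ (⋁ C ch))

    Extreme : Carrier → Set _
    Extreme e = ∀ {x} → T x → x ≤ e → e ≤ x ⊎ next x ≤ e

    extreme-compare : ∀ {e} → Extreme e → ∀ {x} → T x → x ≤ e ⊎ next e ≤ x
    extreme-compare ext (step {y} y∈) with extreme-compare ext y∈
    ... | inj₂ e⁺≤y = inj₂ (≤-trans e⁺≤y (next-≥ y))
    ... | inj₁ y≤e with ext y∈ y≤e
    ...   | inj₁ e≤y  = inj₂ (next-mono-≈ e≤y y≤e)
    ...   | inj₂ y⁺≤e = inj₁ y⁺≤e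
    extreme-compare {e} ext (sup C ch C⊆T) with em {P = ∃[ x ] C x × next e ≤ x}
    ... | yes (x , x∈C , e⁺≤x) = inj₂ (≤-trans e⁺≤x (proj₁ (proj₂ (⋁ C ch)) x∈C))
    ... | no none = inj₁ (proj₂ (proj₂ (⋁ C ch)) below)
      where
      below : ∀ {x} → C x → x ≤ e
      below {x} x∈C with extreme-compare ext (C⊆T x∈C)
      ... | inj₁ x≤e  = x≤e
      ... | inj₂ e⁺≤x = ⊥-elim (none (x , x∈C , e⁺≤x))

    extreme : ∀ {e} → T e → Extreme e
    extreme (step {y} y∈) x∈ x≤y⁺ with extreme-compare (extreme y∈) x∈
    ... | inj₂ y⁺≤x = inj₁ y⁺≤x
    ... | inj₁ x≤y with extreme y∈ x∈ x≤y
    ...   | inj₁ y≤x  = inj₂ (next-mono-≈ x≤y y≤x)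
    ...   | inj₂ x⁺≤y = inj₂ (≤-trans x⁺≤y (next-≥ y))
    extreme (sup C ch C⊆T) {x} x∈ x≤s with em {P = ∃[ d ] C d × ¬ (d ≤ x)}
    ... | no none = inj₁ (proj₂ (proj₂ (⋁ C ch)) λ d∈C → dne λ d≰x → none (_ , d∈C , d≰x))
    ... | yes (d , d∈C , d≰x) with extreme-compare (extreme (C⊆T d∈C)) x∈
    ...   | inj₂ d⁺≤x = ⊥-elim (d≰x (≤-trans (next-≥ d) d⁺≤x))
    ...   | inj₁ x≤d with extreme (C⊆T d∈C) x∈ x≤d
    ...     | inj₁ d≤x  = ⊥-elim (d≰x d≤x)
    ...     | inj₂ x⁺≤d = inj₂ (≤-trans x⁺≤d (proj₁ (proj₂ (⋁ C ch)) d∈C))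

    T-chain : Chain (Squash ∘ T)
    T-chain x∈ y∈ with extreme-compare (extreme (unsquash y∈)) (unsquash x∈)
    ... | inj₁ x≤y  = inj₁ x≤y
    ... | inj₂ y⁺≤x = inj₂ (≤-trans (next-≥ _) y⁺≤x)

    top∈T : T (proj₁ (⋁ (Squash ∘ T) T-chain))
    top∈T = sup (Squash ∘ T) T-chain unsquash

    absurd : ⊥
    absurd = next-≰ _ (proj₁ (proj₂ (⋁ (Squash ∘ T) T-chain)) (squash (step top∈T)))

  zorn : (∀ C → Chain C → ∃ (IsSupremum C)) → ∃ Maximal
  zorn ⋁ = dne λ none →
    let
      larger : ∀ x → ∃[ y ] x ≤ y × ¬ (y ≤ x)
      larger x = dne λ no-larger →
        none (x , λ {y} x≤y → dne λ y≰x → no-larger (y , x≤y , y≰x))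
      open Representatives (representatives ac Eq.setoid)
      -- `larger` need not respect the equality of the poset; composed with `rep` it does.
      next = proj₁ ∘ larger ∘ rep
      next-≥ x = ≤-trans (reflexive (Eq.sym (rep-≈ x))) (proj₁ (proj₂ (larger (rep x))))
      next-≰ x x⁺≤x = proj₂ (proj₂ (larger (rep x)))
        (≤-trans x⁺≤x (reflexive (Eq.sym (rep-≈ x))))
      next-mono : ∀ {x y} → x ≤ y → y ≤ x → next x ≤ next y
      next-mono {x} {y} x≤y y≤x =
        reflexive (Eq.reflexive (cong (proj₁ ∘ larger) (rep-cong (antisym x≤y y≤x))))
    in Tower.absurd ⋁ next next-≥ next-≰ next-mono

value-injective : ∀ {m n} → value m ≡ value n → m ≡ n
value-injective {positive m} {positive n} refl = refl

record Filter (X : Set) : Set₁ where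
  infix 4 _∋ᶠ_
  field
    _∋ᶠ_   : Pred X 0ℓ → Set
    univ   : _∋ᶠ_ U
    proper : ¬ (_∋ᶠ_ ∅)
    upward : ∀ {A B} → A ⊆ B → _∋ᶠ_ A → _∋ᶠ_ B
    meet   : ∀ {A B} → _∋ᶠ_ A → _∋ᶠ_ B → _∋ᶠ_ (A ∩ B)

open Filter using (_∋ᶠ_)

infix 4 _≤ᶠ_

_≤ᶠ_ : ∀ {X} → Filter X → Filter X → Set₁
F ≤ᶠ G = ∀ {A} → F ∋ᶠ A → G ∋ᶠ A

ultrafilter-univ : ∀ {X} (p : Ultrafilter X) → p ∋ U
ultrafilter-univ p with Ultrafilter.ultra p U
... | inj₁ U∈  = U∈
... | inj₂ ∁U∈ = ⊥-elim (Ultrafilter.proper p (Ultrafilter.upward p (λ ¬⊤ → ¬⊤ _) ∁U∈))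

⌊_⌋ : ∀ {X} → Ultrafilter X → Filter X
⌊ p ⌋ = record
  { _∋ᶠ_ = p ∋_ ; univ = ultrafilter-univ p
  ; proper = P.proper ; upward = P.upward ; meet = P.meet }
  where module P = Ultrafilter p

module FilterExtension (em : ∀ {ℓ} → ExcludedMiddle ℓ)
                       (ac : ∀ {a ℓ₁ b ℓ₂} → AxiomOfChoice a ℓ₁ b ℓ₂)
                       {X : Set} where
  open Classical em

  FilterChain : Pred (Filter X) 0ℓ → Set₁
  FilterChain C = ∀ {F G} → C F → C G → F ≤ᶠ G ⊎ G ≤ᶠ F

  ⋃ : (C : Pred (Filter X) 0ℓ) → ∃ C → FilterChain C → Filter X
  ⋃ C (F₀ , F₀∈C) chain = record
    { _∋ᶠ_   = λ A → Squash (∃[ F ] C F × F ∋ᶠ A)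
    ; univ   = squash (F₀ , F₀∈C , Filter.univ F₀)
    ; proper = λ ∅∈ → let F , _ , ∅∈F = unsquash ∅∈ in Filter.proper F ∅∈F
    ; upward = λ A⊆B A∈ → let F , F∈C , A∈F = unsquash A∈ in
        squash (F , F∈C , Filter.upward F A⊆B A∈F)
    ; meet   = λ A∈ B∈ → squash (common (unsquash A∈) (unsquash B∈))
    }
    where
    common : ∀ {A B} → ∃[ F ] C F × F ∋ᶠ A → ∃[ F ] C F × F ∋ᶠ B →
             ∃[ F ] C F × F ∋ᶠ A ∩ B
    common (F , F∈C , A∈F) (G , G∈C , B∈G) with chain F∈C G∈C
    ... | inj₁ F≤G = G , G∈C , Filter.meet G (F≤G A∈F) B∈G
    ... | inj₂ G≤F = F , F∈C , Filter.meet F A∈F (G≤F B∈G)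

  maximalExtension :
    (Q : Filter X → Set₁) →
    (∀ C ne (chain : FilterChain C) → (∀ {F} → C F → Q F) → Q (⋃ C ne chain)) →
    (F₀ : Filter X) → Q F₀ →
    ∃[ F ] F₀ ≤ᶠ F × Q F × (∀ {G} → Q G → F ≤ᶠ G → G ≤ᶠ F)
  maximalExtension Q Q-⋃ F₀ QF₀ =
    F , F₀≤F , QF , λ QG F≤G → maximal {_ , (λ A∈ → F≤G (F₀≤F A∈)) , QG} F≤G
    where
    poset : Poset _ _ _
    poset = record
      { Carrier = Σ[ F ∈ Filter X ] F₀ ≤ᶠ F × Q F
      ; _≈_ = λ (F , _) (G , _) → (F ≤ᶠ G) × (G ≤ᶠ F)
      ; _≤_ = λ (F , _) (G , _) → F ≤ᶠ G
      ; isPartialOrder = record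
        { isPreorder = record
          { isEquivalence = record
            { refl  = (λ A∈ → A∈) , (λ A∈ → A∈)
            ; sym   = λ (F≤G , G≤F) → (λ A∈ → G≤F A∈) , (λ A∈ → F≤G A∈)
            ; trans = λ (F≤G , G≤F) (G≤H , H≤G) →
                (λ A∈ → G≤H (F≤G A∈)) , (λ A∈ → G≤F (H≤G A∈))
            }
          ; reflexive = λ (F≤G , _) → F≤G
          ; trans = λ F≤G G≤H A∈ → G≤H (F≤G A∈)
          }
        ; antisym = λ F≤G G≤F → (λ A∈ → F≤G A∈) , (λ A∈ → G≤F A∈)
        }
      }
    open Zorn em ac poset

    supremum : ∀ C → Chain C → ∃ (IsSupremum C)
    supremum C chain =
      (⋃ C⁺ ne chain⁺ , F₀≤⋃ , Q-⋃ C⁺ ne chain⁺ Q⁺) ,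
      (λ {F} F∈C A∈ → squash (proj₁ F , squash (inj₂ (F , F∈C , refl)) , A∈)) ,
      λ {G} → least {G}
      where
      C⁺ : Pred (Filter X) 0ℓ
      -- `F₀` is adjoined so that there is something to unite even when the chain is empty.
      C⁺ F = Squash (F ≡ F₀ ⊎ ∃[ G ] C G × F ≡ proj₁ G)
      ne = F₀ , squash (inj₁ refl)
      chain⁺ : FilterChain C⁺
      chain⁺ F∈ G∈ with unsquash F∈ | unsquash G∈
      ... | inj₁ refl | inj₁ refl = inj₁ λ A∈ → A∈
      ... | inj₁ refl | inj₂ ((_ , F₀≤G , _) , _ , refl) = inj₁ F₀≤G
      ... | inj₂ ((_ , F₀≤F , _) , _ , refl) | inj₁ refl = inj₂ F₀≤F
      ... | inj₂ (_ , F∈C , refl) | inj₂ (_ , G∈C , refl) = chain F∈C G∈C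
      F₀≤⋃ : F₀ ≤ᶠ ⋃ C⁺ ne chain⁺
      F₀≤⋃ A∈ = squash (F₀ , squash (inj₁ refl) , A∈)
      Q⁺ : ∀ {F} → C⁺ F → Q F
      Q⁺ F∈ with unsquash F∈
      ... | inj₁ refl = QF₀
      ... | inj₂ ((_ , _ , QF) , _ , refl) = QF
      least : ∀ {G : Poset.Carrier poset} → (∀ {F} → C F → proj₁ F ≤ᶠ proj₁ G) →
              ⋃ C⁺ ne chain⁺ ≤ᶠ proj₁ G
      least {G , F₀≤G , _} bound A∈ with unsquash A∈
      ... | F , F∈ , A∈F with unsquash F∈
      ...   | inj₁ refl = F₀≤G A∈F
      ...   | inj₂ (_ , F∈C , refl) = bound F∈C A∈F

    maximum = zorn supremum
    F = proj₁ (proj₁ maximum)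
    F₀≤F = proj₁ (proj₂ (proj₁ maximum))
    QF = proj₂ (proj₂ (proj₁ maximum))
    maximal = proj₂ maximum

  adjoin : (F : Filter X) (A : Pred X 0ℓ) → ¬ (F ∋ᶠ ∁ A) → Filter X
  adjoin F A ∁A∉F = record
    { _∋ᶠ_   = λ B → F ∋ᶠ (λ x → A x → B x)
    ; univ   = upward _ univ
    ; proper = ∁A∉F
    ; upward = λ B⊆C → upward λ A⇒B x∈A → B⊆C (A⇒B x∈A)
    ; meet   = λ B∈ C∈ → upward (λ (A⇒B , A⇒C) x∈A → A⇒B x∈A , A⇒C x∈A) (meet B∈ C∈)
    }
    where open Filter F

  maximal⇒ultra : (F : Filter X) → (∀ {G} → F ≤ᶠ G → G ≤ᶠ F) → ∀ A → F ∋ᶠ A ⊎ F ∋ᶠ ∁ A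
  maximal⇒ultra F maximal A with em {P = F ∋ᶠ ∁ A}
  ... | yes ∁A∈ = inj₂ ∁A∈
  ... | no  ∁A∉ = inj₁ (maximal {adjoin F A ∁A∉}
                    (upward λ x∈B _ → x∈B) (upward (λ _ x∈A → x∈A) univ))
    where open Filter F

  ultrafilterExtension : (F : Filter X) → ∃[ p ] F ≤ᶠ ⌊ p ⌋
  ultrafilterExtension F₀ =
    fromMaximal (maximalExtension (λ _ → Lift _ ⊤) (λ _ _ _ _ → lift tt) F₀ (lift tt))
    where
    fromMaximal : (∃[ F ] F₀ ≤ᶠ F × Lift _ ⊤ × (∀ {G} → Lift _ ⊤ → F ≤ᶠ G → G ≤ᶠ F)) →
                  ∃[ p ] F₀ ≤ᶠ ⌊ p ⌋
    fromMaximal (F , F₀≤F , _ , maximal) =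
      record { _∋_ = F ∋ᶠ_ ; proper = proper ; upward = upward ; meet = meet
             ; ultra = maximal⇒ultra F λ {G} → maximal {G} (lift tt) } , F₀≤F
      where open Filter F

-- Idempotent ultrafilters above a filter

+-assoc⁺ : ∀ x y z → (x + y) + z ≡ x + (y + z)
+-assoc⁺ x y z = value-injective (ℕ.+-assoc (value x) (value y) (value z))

infixl 6 _⊕ᶠ_

_⊕ᶠ_ : Filter ℕ⁺ → Filter ℕ⁺ → Filter ℕ⁺
F ⊕ᶠ G = record
  { _∋ᶠ_   = λ A → F ∋ᶠ (λ x → G ∋ᶠ (λ y → A (x + y)))
  ; univ   = F.upward (λ _ → G.univ) F.univ
  ; proper = λ ∅∈ → F.proper (F.upward (λ ∅∈G → G.proper ∅∈G) ∅∈)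
  ; upward = λ A⊆B → F.upward (G.upward A⊆B)
  ; meet   = λ A∈ B∈ → F.upward (λ (A∈G , B∈G) → G.meet A∈G B∈G) (F.meet A∈ B∈)
  }
  where
  module F = Filter F
  module G = Filter G

-- Papazyan's argument: a filter maximal among those with F ≤ F ⊕ F absorbs
-- every ultrafilter p above it, and then contains {x : -x + A ∈ p} for all
-- A ∈ p, so that p is idempotent.
module IdempotentExtension (em : ∀ {ℓ} → ExcludedMiddle ℓ)
                           (ac : ∀ {a ℓ₁ b ℓ₂} → AxiomOfChoice a ℓ₁ b ℓ₂) where
  open Classical em
  open FilterExtension em ac {ℕ⁺}

  Q : Filter ℕ⁺ → Set₁
  Q F = F ≤ᶠ F ⊕ᶠ F

  Q-⋃ : ∀ C ne (chain : FilterChain C) → (∀ {F} → C F → Q F) → Q (⋃ C ne chain)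
  Q-⋃ C ne chain QC {A} A∈ with unsquash A∈
  ... | F , F∈C , A∈F = squash (F , F∈C ,
          Filter.upward F (λ {x} A-x∈F → squash (F , F∈C , A-x∈F)) (QC F∈C {A} A∈F))

  maximal⇒idempotent : (F : Filter ℕ⁺) → Q F → (∀ {G} → Q G → F ≤ᶠ G → G ≤ᶠ F) →
                       ∀ p → F ≤ᶠ ⌊ p ⌋ → Idempotent p
  maximal⇒idempotent F QF maximal p F≤p = idempotent
    where
    module F = Filter F
    module P = Ultrafilter p

    F≤F⊕p : F ≤ᶠ F ⊕ᶠ ⌊ p ⌋
    F≤F⊕p {A} A∈ = F.upward F≤p (QF {A} A∈)

    -- By `QF` twice, F ≤ F ⊕ F ⊕ F, where the middle factor may be enlarged to p; then p is added
    -- on the right.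
    Q-F⊕p : Q (F ⊕ᶠ ⌊ p ⌋)
    Q-F⊕p {A} A∈ =
      F.upward (λ {x} E-x∈F → F≤p
          (F.upward (λ {y} E-xy∈F →
             F.upward (λ {z} A∈p → P.upward (λ {w} → subst A (regroup x y z w)) A∈p) E-xy∈F)
           (QF {λ y → E (x + y)} E-x∈F)))
        (QF {E} A∈)
      where
      E : Pred ℕ⁺ 0ℓ
      E x = p ∋ λ w → A (x + w)
      regroup : ∀ x y z w → (x + (y + z)) + w ≡ (x + y) + (z + w)
      regroup x y z w = trans (cong (_+ w) (sym (+-assoc⁺ x y z))) (+-assoc⁺ (x + y) z w)

    F⊕p≤F : F ⊕ᶠ ⌊ p ⌋ ≤ᶠ F
    F⊕p≤F {A} = maximal {F ⊕ᶠ ⌊ p ⌋} (λ {A} → Q-F⊕p {A}) F≤F⊕p {A}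

    _′ : Pred ℕ⁺ 0ℓ → Pred ℕ⁺ 0ℓ
    (A ′) x = p ∋ λ y → A (x + y)

    -- The filter generated by F and all `A ′` with A in p. A single A suffices because
    -- `(A₁ ∩ A₂) ′` is contained in both `A₁ ′` and `A₂ ′`.
    G : Filter ℕ⁺
    G = record
      { _∋ᶠ_   = λ B → Squash (∃[ A ] p ∋ A × F ∋ᶠ (λ x → (A ′) x → B x))
      ; univ   = squash (U , ultrafilter-univ p , F.upward (λ _ _ → _) F.univ)
      ; proper = λ ∅∈ → not-disjoint (unsquash ∅∈)
      ; upward = λ B⊆C B∈ → let A , A∈ , B∈F = unsquash B∈ in
          squash (A , A∈ , F.upward (λ A′⇒B x∈A′ → B⊆C (A′⇒B x∈A′)) B∈F)
      ; meet   = λ B∈ C∈ →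
          let A₁ , A₁∈ , B∈F = unsquash B∈
              A₂ , A₂∈ , C∈F = unsquash C∈
          in squash (A₁ ∩ A₂ , P.meet A₁∈ A₂∈ ,
               F.upward (λ (A₁⇒B , A₂⇒C) x∈ →
                  A₁⇒B (P.upward proj₁ x∈) , A₂⇒C (P.upward proj₂ x∈))
                 (F.meet B∈F C∈F))
      }
      where
      not-disjoint : ¬ (∃[ A ] p ∋ A × F ∋ᶠ ∁ (A ′))
      -- Were the complement of `A ′` in F, then so would be `(∁ A) ′`; thus `∁ A` would lie in F ⊕
      -- p, hence in F and in p.
      not-disjoint (A , A∈ , ∁A′∈) = P.proper (P.upward (λ (x∈A , x∉A) → x∉A x∈A)
        (P.meet A∈ (F≤p (F⊕p≤F {∁ A} (F.upward (λ {x} → complement {x}) ∁A′∈)))))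
        where
        complement : ∀ {x} → ¬ (A ′) x → (∁ A ′) x
        complement {x} x∉A′ with P.ultra (λ y → A (x + y))
        ... | inj₁ x∈A′ = ⊥-elim (x∉A′ x∈A′)
        ... | inj₂ x∈∁A′ = x∈∁A′

    F≤G : F ≤ᶠ G
    F≤G B∈ = squash (U , ultrafilter-univ p , F.upward (λ x∈B _ → x∈B) B∈)

    ′∈G : ∀ {A} → p ∋ A → G ∋ᶠ A ′
    ′∈G {A} A∈ = squash (A , A∈ , F.upward (λ _ x∈ → x∈) F.univ)

    -- For x in `A ′` the set `-x + A` is in p, so G contains `(-x + A) ′`, which is `A ′`
    -- translated by -x.
    QG : Q G
    QG {B} B∈ with unsquash B∈
    ... | A , A∈ , B∈F = Filter.upward G
      (λ {x} (B-x∈F , x∈A′) → Filter.upward G (λ (A′⇒B , y∈) → A′⇒B y∈)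
         (Filter.meet G (F≤G B-x∈F)
           (Filter.upward G (λ {y} → P.upward (λ {w} → subst A (sym (+-assoc⁺ x y w))))
             (′∈G {λ y → A (x + y)} x∈A′))))
      (Filter.meet G (F≤G (QF {λ x → (A ′) x → B x} B∈F)) (′∈G A∈))

    p≤p⊕p : ∀ {A} → p ∋ A → p ⊕ p ∋ A
    p≤p⊕p A∈ = F≤p (maximal {G} (λ {B} → QG {B}) F≤G (′∈G A∈))

    idempotent : Idempotent p
    idempotent A = mk⇔ from p≤p⊕p
      where
      from : p ⊕ p ∋ A → p ∋ A
      from A∈ with P.ultra A
      ... | inj₁ A∈p  = A∈p
      ... | inj₂ ∁A∈p = ⊥-elim (Ultrafilter.proper (p ⊕ p)
              (Ultrafilter.upward (p ⊕ p) {A ∩ ∁ A} (λ (x∈A , x∉A) → x∉A x∈A)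
                (Ultrafilter.meet (p ⊕ p) {A} {∁ A} A∈ (p≤p⊕p ∁A∈p))))

  idempotentExtension : (F₀ : Filter ℕ⁺) → F₀ ≤ᶠ F₀ ⊕ᶠ F₀ →
                        ∃[ p ] F₀ ≤ᶠ ⌊ p ⌋ × Idempotent p
  idempotentExtension F₀ Q₀ =
    fromMaximal (maximalExtension Q Q-⋃ F₀ (λ {A} → Q₀ {A}))
    where
    fromMaximal : (∃[ F ] F₀ ≤ᶠ F × Q F × (∀ {G} → Q G → F ≤ᶠ G → G ≤ᶠ F)) →
                  ∃[ p ] F₀ ≤ᶠ ⌊ p ⌋ × Idempotent p
    fromMaximal (F , F₀≤F , QF , maximal) = above (ultrafilterExtension F)
      where
      above : (∃[ p ] F ≤ᶠ ⌊ p ⌋) → ∃[ p ] F₀ ≤ᶠ ⌊ p ⌋ × Idempotent p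
      above (p , F≤p) =
        p , (λ A∈ → F≤p (F₀≤F A∈)) ,
          maximal⇒idempotent F QF (λ {G} → maximal {G}) p F≤p

-- The Hales–Jewett theorem

-- The positions holding nothing are the active ones of a combinatorial line.
Template : Set → ℕ.ℕ → Set
Template A n = Vec (Maybe A) n

Active : ∀ {A n} → Template A n → Set
Active ℓ = nothing ∈ᵛ ℓ

infixl 8 _⟪_⟫

_⟪_⟫ : ∀ {A : Set} {n} → Template A n → A → Vec A n
ℓ ⟪ a ⟫ = Vec.map (fromMaybe a) ℓ

constant : ∀ {A : Set} {n} → Vec A n → Template A n
constant = Vec.map just

constant-⟪⟫ : ∀ {A : Set} {n} (w : Vec A n) a → constant w ⟪ a ⟫ ≡ w
constant-⟪⟫ w a = trans (sym (Vec.map-∘ (fromMaybe a) just w)) (Vec.map-id w)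

++-⟪⟫ : ∀ {A : Set} {m n} (ℓ : Template A m) (ℓ′ : Template A n) a →
        (ℓ ++ ℓ′) ⟪ a ⟫ ≡ ℓ ⟪ a ⟫ ++ ℓ′ ⟪ a ⟫
++-⟪⟫ ℓ ℓ′ a = Vec.map-++ (fromMaybe a) ℓ ℓ′

map-⟪⟫ : ∀ {A B : Set} {n} (f : A → B) (ℓ : Template A n) a →
         Vec.map (Maybe.map f) ℓ ⟪ f a ⟫ ≡ Vec.map f (ℓ ⟪ a ⟫)
map-⟪⟫ f [] a = refl
map-⟪⟫ f (just x ∷ ℓ) a = cong (f x ∷_) (map-⟪⟫ f ℓ a)
map-⟪⟫ f (nothing ∷ ℓ) a = cong (f a ∷_) (map-⟪⟫ f ℓ a)

active-++ˡ : ∀ {A m n} {ℓ : Template A m} {ℓ′ : Template A n} → Active ℓ → Active (ℓ ++ ℓ′)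
active-++ˡ = ∈ᵛ.∈-++⁺ˡ

active-++ʳ : ∀ {A m n} (ℓ : Template A m) {ℓ′ : Template A n} → Active ℓ′ → Active (ℓ ++ ℓ′)
active-++ʳ ℓ = ∈ᵛ.∈-++⁺ʳ ℓ

MonochromaticLine : ∀ {A : Set} {n r} → (Vec A n → Fin r) → Set
MonochromaticLine {A} {n} C =
  ∃[ ℓ ] Active ℓ × (∀ (a b : A) → C (ℓ ⟪ a ⟫) ≡ C (ℓ ⟪ b ⟫))

HalesJewett : ℕ.ℕ → Set
HalesJewett k = ∀ r → ∃[ n ] ((C : Vec (Fin (ℕ.suc k)) (ℕ.suc n) → Fin r) → MonochromaticLine C)

-- Colour focusing: s lines meet in `focus` at the top letter and carry s different colours below
-- it.
record Focused {k n r} (C : Vec (Fin (2 ℕ.+ k)) n → Fin r) (s : ℕ.ℕ) : Set where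
  field
    focus       : Vec (Fin (2 ℕ.+ k)) n
    line        : Fin s → Template (Fin (2 ℕ.+ k)) n
    active      : ∀ i → Active (line i)
    focused     : ∀ i → line i ⟪ fromℕ (ℕ.suc k) ⟫ ≡ focus
    colour      : Fin s → Fin r
    coloured    : ∀ i a → C (line i ⟪ inject₁ a ⟫) ≡ colour i
    distinct    : ∀ {i j} → colour i ≡ colour j → i ≡ j

monochromatic : ∀ {k n r} {C : Vec (Fin (ℕ.suc k)) n → Fin r} {ℓ c} →
  (∀ a → C (ℓ ⟪ inject₁ a ⟫) ≡ c) → C (ℓ ⟪ fromℕ k ⟫) ≡ c →
  ∀ a b → C (ℓ ⟪ a ⟫) ≡ C (ℓ ⟪ b ⟫)
monochromatic {C = C} {ℓ} {c} low top a b = trans (all a) (sym (all b))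
  where
  all : ∀ a → C (ℓ ⟪ a ⟫) ≡ c
  all a with view a
  ... | ‵fromℕ = top
  ... | ‵inject₁ i = low i

module _ {k m n r} (C : Vec (Fin k) (m ℕ.+ n) → Fin r) where

  -- The whole row y ↦ C (x ++ y), counted as one of finitely many colours.
  rowColour : Vec (Fin k) m → Fin (r ℕ.^ (k ℕ.^ n))
  rowColour x = funToFin λ i → C (x ++ tabulate (finToFun {k} {n} i))

  rowColour-injective : ∀ {x x′} → rowColour x ≡ rowColour x′ → ∀ y → C (x ++ y) ≡ C (x′ ++ y)
  rowColour-injective {x} {x′} eq y = begin
    C (x ++ y)                 ≡⟨ cong (λ y → C (x ++ y)) (decode y) ⟨
    row x (code y)             ≡⟨ Fin.finToFun-funToFin (row x) (code y) ⟨
    finToFun (rowColour x) (code y)  ≡⟨ cong (λ c → finToFun c (code y)) eq ⟩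
    finToFun (rowColour x′) (code y) ≡⟨ Fin.finToFun-funToFin (row x′) (code y) ⟩
    row x′ (code y)            ≡⟨ cong (λ y → C (x′ ++ y)) (decode y) ⟩
    C (x′ ++ y)                ∎
    where
    open ≡-Reasoning
    row : Vec (Fin k) m → Fin (k ℕ.^ n) → Fin r
    row x i = C (x ++ tabulate (finToFun {k} {n} i))
    code : Vec (Fin k) n → Fin (k ℕ.^ n)
    code y = funToFin (lookup y)
    decode : ∀ y → tabulate (finToFun (code y)) ≡ y
    decode y = trans (Vec.tabulate-cong (Fin.finToFun-funToFin (lookup y))) (Vec.tabulate∘lookup y)

-- A line κ for the colouring of prefixes by rowColour, prolonged by each of the
-- s focused lines and by their constant focus, yields s + 1 focused lines.
focus-step : ∀ {k} → HalesJewett k → ∀ r s →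
  ∃[ n ] ((C : Vec (Fin (2 ℕ.+ k)) (ℕ.suc n) → Fin r) → MonochromaticLine C ⊎ Focused C s)
focus-step hj r ℕ.zero = 0 , λ C → inj₂ record
  { focus = zero ∷ [] ; line = λ () ; active = λ () ; focused = λ ()
  ; colour = λ () ; coloured = λ () ; distinct = λ { {()} } }
focus-step {k} hj r (ℕ.suc s) with focus-step hj r s
... | n , ih with hj (r ℕ.^ ((2 ℕ.+ k) ℕ.^ ℕ.suc n))
...   | m , hj-m = m ℕ.+ ℕ.suc n , extend
  where
  K = 2 ℕ.+ k
  extend : (C : Vec (Fin K) (ℕ.suc m ℕ.+ ℕ.suc n) → Fin r) →
           MonochromaticLine C ⊎ Focused C (ℕ.suc s)
  extend C with hj-m (λ x → rowColour {m = ℕ.suc m} C (Vec.map inject₁ x))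
  ... | κ , κ-active , κ-mono = result (ih C₀)
    where
    λᵐ : Template (Fin K) (ℕ.suc m)
    λᵐ = Vec.map (Maybe.map inject₁) κ

    λ-active : Active λᵐ
    λ-active = ∈ᵛ.∈-map⁺ (Maybe.map inject₁) κ-active

    x₀ = λᵐ ⟪ inject₁ zero ⟫

    C₀ : Vec (Fin K) (ℕ.suc n) → Fin r
    C₀ y = C (x₀ ++ y)

    C≡C₀ : ∀ a y → C (λᵐ ⟪ inject₁ a ⟫ ++ y) ≡ C₀ y
    C≡C₀ a y = rowColour-injective {m = ℕ.suc m} C
      (trans (cong (rowColour {m = ℕ.suc m} C) (map-⟪⟫ inject₁ κ a))
      (trans (κ-mono a zero) (cong (rowColour {m = ℕ.suc m} C) (sym (map-⟪⟫ inject₁ κ zero))))) y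

    liftLine : MonochromaticLine C₀ → MonochromaticLine C
    liftLine (ℓ , active , mono) = constant x₀ ++ ℓ , active-++ʳ (constant x₀) active ,
      λ a b → trans (cong C (eq a)) (trans (mono a b) (cong C (sym (eq b))))
      where
      eq : ∀ a → (constant x₀ ++ ℓ) ⟪ a ⟫ ≡ x₀ ++ ℓ ⟪ a ⟫
      eq a = trans (++-⟪⟫ (constant x₀) ℓ a) (cong (_++ ℓ ⟪ a ⟫) (constant-⟪⟫ x₀ a))

    result : MonochromaticLine C₀ ⊎ Focused C₀ s → MonochromaticLine C ⊎ Focused C (ℕ.suc s)
    result (inj₁ mono) = inj₁ (liftLine mono)
    -- If a focused line has the colour of the focus, its top point agrees with the rest. Otherwise
    -- that colour is new and goes to the line that varies only the prefix.
    result (inj₂ foc) with Fin.any? (λ i → Focused.colour foc i Fin.≟ C₀ (Focused.focus foc))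
    ... | yes (i , eq) = inj₁ (liftLine (line i , active i ,
            monochromatic {C = C₀} {ℓ = line i} (coloured i) (trans (cong C₀ (focused i)) (sym eq))))
      where open Focused foc
    ... | no fresh = inj₂ record
      { focus    = λᵐ ⟪ fromℕ (ℕ.suc k) ⟫ ++ focus
      ; line     = (λᵐ ++ constant focus) Vector.∷ λ i → λᵐ ++ line i
      ; active   = λ { zero → active-++ˡ λ-active ; (suc i) → active-++ˡ λ-active }
      ; focused  = λ
        { zero → trans (++-⟪⟫ λᵐ (constant focus) _) (cong (λᵐ ⟪ _ ⟫ ++_) (constant-⟪⟫ focus _))
        ; (suc i) → trans (++-⟪⟫ λᵐ (line i) _) (cong (λᵐ ⟪ _ ⟫ ++_) (focused i)) }
      ; colour   = C₀ focus Vector.∷ colour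
      ; coloured = λ
        { zero a → trans (cong C (trans (++-⟪⟫ λᵐ (constant focus) _)
                     (cong (λᵐ ⟪ _ ⟫ ++_) (constant-⟪⟫ focus _)))) (C≡C₀ a focus)
        ; (suc i) a → trans (cong C (++-⟪⟫ λᵐ (line i) _))
                     (trans (C≡C₀ a (line i ⟪ inject₁ a ⟫)) (coloured i a)) }
      ; distinct = λ
        { {zero}  {zero}  _  → refl
        ; {zero}  {suc j} eq → ⊥-elim (fresh (j , sym eq))
        ; {suc i} {zero}  eq → ⊥-elim (fresh (i , eq))
        ; {suc i} {suc j} eq → cong suc (distinct eq) }
      }
      where open Focused foc

halesJewett : ∀ k → HalesJewett k
halesJewett ℕ.zero r = 0 , λ C → nothing ∷ [] , here refl , λ { zero zero → refl }
-- One focused line more than there are colours: two of them would share a colour.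
halesJewett (ℕ.suc k) r with focus-step (halesJewett k) r (ℕ.suc r)
... | n , lines = n , λ C → decide C (lines C)
  where
  decide : ∀ C → MonochromaticLine C ⊎ Focused C (ℕ.suc r) → MonochromaticLine C
  decide C (inj₁ mono) = mono
  decide C (inj₂ foc) with Fin.pigeonhole (ℕ.n<1+n r) (Focused.colour foc)
  ... | i , j , i<j , eq = ⊥-elim (ℕ.<-irrefl (cong Fin.toℕ (Focused.distinct foc eq)) i<j)

-- Finite sums and J-sets

sumOver : ∀ {X : Set} → List X → (X → ℕ.ℕ) → ℕ.ℕ
sumOver L h = sum (List.map h L)

sumOver-cong : ∀ {X : Set} (L : List X) {h k : X → ℕ.ℕ} → h ≗ k → sumOver L h ≡ sumOver L k
sumOver-cong L h≗k = cong sum (List.map-cong h≗k L)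

sumOver-+ : ∀ {X : Set} (L : List X) (h k : X → ℕ.ℕ) →
            sumOver L (λ x → h x ℕ.+ k x) ≡ sumOver L h ℕ.+ sumOver L k
sumOver-+ [] h k = refl
sumOver-+ (x ∷ L) h k = trans (cong (h x ℕ.+ k x ℕ.+_) (sumOver-+ L h k))
  (interchange ℕ.+-commutativeSemigroup (h x) (k x) (sumOver L h) (sumOver L k))

sumOver-cartesianProductWith : ∀ {X Y Z : Set} (g : X → Y → Z) (L : List X) (M : List Y) h →
  sumOver (cartesianProductWith g L M) h ≡ sumOver L (λ x → sumOver M (h ∘ g x))
sumOver-cartesianProductWith g [] M h = refl
sumOver-cartesianProductWith g (x ∷ L) M h = begin
  sum (List.map h (List.map (g x) M List.++ cartesianProductWith g L M))
    ≡⟨ cong sum (List.map-++ h (List.map (g x) M) _) ⟩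
  sum (List.map h (List.map (g x) M) List.++ List.map h (cartesianProductWith g L M))
    ≡⟨ sum-++ (List.map h (List.map (g x) M)) _ ⟩
  sum (List.map h (List.map (g x) M)) ℕ.+ sumOver (cartesianProductWith g L M) h
    ≡⟨ cong₂ ℕ._+_ (cong sum (sym (List.map-∘ M))) (sumOver-cartesianProductWith g L M h) ⟩
  sumOver M (h ∘ g x) ℕ.+ sumOver L (λ x → sumOver M (h ∘ g x)) ∎
  where open ≡-Reasoning

module _ (β : 𝒫fℕ) where

  support : List ℕ⁺
  support = toList (removeRepeats β)

  support-unique : Unique support
  support-unique = All.all-filter (¬? ∘ (_≟_ (List⁺.head β))) (List.deduplicate _≟_ (List⁺.tail β))
    ∷ Unique.filter⁺ _ (deduplicate-! (List⁺.tail β))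

  ∈-support : ∀ {x} → x ∈ˡ support → x ∈ˡ toList β
  ∈-support (here refl) = here refl
  ∈-support (there x∈) =
    there (∈ˡ.∈-deduplicate⁻ _≟_ (List⁺.tail β) (proj₁ (∈ˡ.∈-filter⁻ _ x∈)))

  value-∑ : ∀ f → value (∑ β f) ≡ sumOver support (value ∘ f)
  value-∑ f = go (List⁺.head (removeRepeats β)) (List⁺.tail (removeRepeats β))
    where
    go : ∀ x xs → value (foldr₁ _+_ (List⁺.map f (x ∷ xs))) ≡ sumOver (x ∷ xs) (value ∘ f)
    go x [] = sym (ℕ.+-identityʳ _)
    go x (y ∷ ys) = cong (value (f x) ℕ.+_) (go y ys)

deduplicate-unique : ∀ {xs} → Unique xs → List.deduplicate _≟_ xs ≡ xs
deduplicate-unique [] = refl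
deduplicate-unique {x ∷ xs} (x∉ ∷ u) = cong (x ∷_)
  (trans (cong (filter (¬? ∘ (x ≟_))) (deduplicate-unique u)) (List.filter-all _ x∉))

support-id : ∀ β → Unique (toList β) → support β ≡ toList β
support-id (x ∷ xs) (x∉ ∷ u) = deduplicate-unique (x∉ ∷ u)

∑-unique : ∀ β → Unique (toList β) → ∀ f → value (∑ β f) ≡ sumOver (toList β) (value ∘ f)
∑-unique β u f = trans (value-∑ β f) (cong (λ L → sumOver L (value ∘ f)) (support-id β u))

∑-cong : ∀ β {f g : ℕ⁺ → ℕ⁺} → f ≗ g → ∑ β f ≡ ∑ β g
∑-cong β f≗g = cong₂ (λ y ys → foldr₁ _+_ (y ∷ ys)) (f≗g (List⁺.head β))
  (List.map-cong f≗g (List⁺.tail (removeRepeats β)))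

removeRepeats-∑ : ∀ β f → ∑ (removeRepeats β) f ≡ ∑ β f
removeRepeats-∑ β f = value-injective
  (trans (∑-unique (removeRepeats β) (support-unique β) f) (sym (value-∑ β f)))

∑-map : ∀ β → Unique (toList β) → (σ : ℕ⁺ → ℕ⁺) → (∀ {x y} → σ x ≡ σ y → x ≡ y) →
        ∀ f → ∑ (List⁺.map σ β) f ≡ ∑ β (f ∘ σ)
∑-map β u σ σ-inj f = value-injective (begin
  value (∑ (List⁺.map σ β) f)                  ≡⟨ ∑-unique (List⁺.map σ β) (Unique.map⁺ σ-inj u) f ⟩
  sumOver (toList (List⁺.map σ β)) (value ∘ f) ≡⟨ cong sum (List.map-∘ (toList β)) ⟨
  sumOver (toList β) (value ∘ f ∘ σ)           ≡⟨ ∑-unique β u (f ∘ σ) ⟨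
  value (∑ β (f ∘ σ))                          ∎)
  where open ≡-Reasoning

infixl 6 _+₀_

_+₀_ : ℕ⁺ → ℕ.ℕ → ℕ⁺
positive m +₀ n = positive (m ℕ.+ n) {{+-nonZero m n}}

J-set-⊆ : ∀ A B → A ⊆ B → J-set A → J-set B
J-set-⊆ A B A⊆B J F = let a , β , ∈A = J F in a , β , λ f∈ → A⊆B (∈A f∈)

∈-++ˡ : ∀ (F G : 𝒫fℕ^ℕ) {f} → f ∈ F → f ∈ (F ⁺++⁺ G)
∈-++ˡ F G = Any.++⁺ˡ

∈-++ʳ : ∀ (F G : 𝒫fℕ^ℕ) {f} → f ∈ G → f ∈ (F ⁺++⁺ G)
∈-++ʳ F G = Any.++⁺ʳ (toList F)

-- `position y i` is place i of block y, the blocks having length n + 1. A word is read along every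
-- block, letter i at place i, and so becomes a single function.
module Block (n : ℕ.ℕ) where

  position : ℕ⁺ → Fin (ℕ.suc n) → ℕ⁺
  position (positive y) i =
    positive (ℕ.suc n ℕ.* y ℕ.+ Fin.toℕ i) {{+-nonZero _ _ {{ℕ.m*n≢0 (ℕ.suc n) y}}}}

  position-injective : ∀ {y z i j} → position y i ≡ position z j → y ≡ z × i ≡ j
  position-injective {y} {z} {i} {j} eq =
    value-injective (ℕ.*-cancelˡ-≡ _ _ (ℕ.suc n) (ℕ.+-cancelʳ-≡ (Fin.toℕ j) _ _
      (subst (λ k → ℕ.suc n ℕ.* value y ℕ.+ Fin.toℕ k ≡ _) i≡j eqᵥ))) , i≡j
    where
    eqᵥ : ℕ.suc n ℕ.* value y ℕ.+ Fin.toℕ i ≡ ℕ.suc n ℕ.* value z ℕ.+ Fin.toℕ j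
    eqᵥ = cong value eq
    remainder : ∀ y (i : Fin (ℕ.suc n)) → (ℕ.suc n ℕ.* y ℕ.+ Fin.toℕ i) ℕ.% ℕ.suc n ≡ Fin.toℕ i
    remainder y i = trans (cong (ℕ._% ℕ.suc n)
        (trans (ℕ.+-comm (ℕ.suc n ℕ.* y) _) (cong (Fin.toℕ i ℕ.+_) (ℕ.*-comm (ℕ.suc n) y))))
      (trans (ℕ.[m+kn]%n≡m%n (Fin.toℕ i) y (ℕ.suc n)) (ℕ.m<n⇒m%n≡m (Fin.toℕ<n i)))
    i≡j : i ≡ j
    i≡j = Fin.toℕ-injective (trans (sym (remainder (value y) i))
      (trans (cong (ℕ._% ℕ.suc n) eqᵥ) (remainder (value z) j)))

  module _ {X : Set} (fn : X → ℕ⁺ → ℕ⁺) where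

    term : X → ℕ⁺ → Fin (ℕ.suc n) → ℕ.ℕ
    term c y i = value (fn c (position y i))

    wordFunction : Vec X (ℕ.suc n) → ℕ⁺ → ℕ⁺
    wordFunction w y = fn (lookup w zero) (position y zero) +₀
      sumOver (List.tabulate suc) (λ i → term (lookup w i) y i)

    constTerm : Template X (ℕ.suc n) → ℕ⁺ → Fin (ℕ.suc n) → ℕ.ℕ
    constTerm ℓ y i = maybe′ (λ c → term c y i) 0 (lookup ℓ i)

    constSum : Template X (ℕ.suc n) → List ℕ⁺ → ℕ.ℕ
    constSum ℓ L = sumOver L λ y → sumOver (allFin _) (constTerm ℓ y)

    nothing? : (x : Maybe X) → Dec (nothing ≡ x)
    nothing? nothing  = yes refl
    nothing? (just _) = no λ ()

    activeIndices : Template X (ℕ.suc n) → List (Fin (ℕ.suc n))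
    activeIndices ℓ = filter (nothing? ∘ lookup ℓ) (allFin _)

    row-split : ∀ ℓ c y I →
      sumOver I (λ i → term (lookup (ℓ ⟪ c ⟫) i) y i) ≡
      sumOver I (constTerm ℓ y) ℕ.+ sumOver (filter (nothing? ∘ lookup ℓ) I) (term c y)
    row-split ℓ c y [] = refl
    row-split ℓ c y (i ∷ I) rewrite Vec.lookup-map i (fromMaybe c) ℓ with lookup ℓ i
    ... | just d  = trans (cong (term d y i ℕ.+_) (row-split ℓ c y I))
                      (sym (ℕ.+-assoc (term d y i) _ _))
    ... | nothing = trans (cong (term c y i ℕ.+_) (row-split ℓ c y I))
                      (x∙yz≈y∙xz ℕ.+-commutativeSemigroup (term c y i) (sumOver I (constTerm ℓ y)) _)

    line-sum : ∀ ℓ c L →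
      sumOver L (λ y → value (wordFunction (ℓ ⟪ c ⟫) y)) ≡
      constSum ℓ L ℕ.+ sumOver (cartesianProductWith position L (activeIndices ℓ)) (value ∘ fn c)
    line-sum ℓ c L = begin
      sumOver L (λ y → sumOver (allFin _) (λ i → term (lookup (ℓ ⟪ c ⟫) i) y i))
        ≡⟨ sumOver-cong L (λ y → row-split ℓ c y (allFin _)) ⟩
      sumOver L (λ y → sumOver (allFin _) (constTerm ℓ y) ℕ.+ sumOver (activeIndices ℓ) (term c y))
        ≡⟨ sumOver-+ L _ _ ⟩
      constSum ℓ L ℕ.+ sumOver L (λ y → sumOver (activeIndices ℓ) (term c y))
        ≡⟨ cong (constSum ℓ L ℕ.+_)
             (sumOver-cartesianProductWith position L (activeIndices ℓ) (value ∘ fn c)) ⟨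
      constSum ℓ L ℕ.+ sumOver (cartesianProductWith position L (activeIndices ℓ)) (value ∘ fn c) ∎
      where open ≡-Reasoning

    -- β′ collects the active positions over all y ∈ β; every other term is
    -- independent of c and absorbed into a′.
    collapse : ∀ ℓ → Active ℓ → ∀ a β → ∃[ a′ ] ∃[ β′ ] (∀ c →
      a + ∑ β (wordFunction (ℓ ⟪ c ⟫)) ≡ a′ + ∑ β′ (fn c))
    collapse ℓ active a β = a +₀ constSum ℓ L , β′ , λ c → value-injective (begin
      value a ℕ.+ value (∑ β (wordFunction (ℓ ⟪ c ⟫)))
        ≡⟨ cong (value a ℕ.+_) (trans (value-∑ β _) (line-sum ℓ c L)) ⟩
      value a ℕ.+ (constSum ℓ L ℕ.+ sumOver L′ (value ∘ fn c))
        ≡⟨ ℕ.+-assoc (value a) _ _ ⟨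
      value a ℕ.+ constSum ℓ L ℕ.+ sumOver L′ (value ∘ fn c)
        ≡⟨ cong (value a ℕ.+ constSum ℓ L ℕ.+_) (∑β′ c) ⟨
      value a ℕ.+ constSum ℓ L ℕ.+ value (∑ β′ (fn c)) ∎)
      where
      open ≡-Reasoning
      L = support β
      L′ = cartesianProductWith position L (activeIndices ℓ)
      L′-unique : Unique L′
      L′-unique = Unique.cartesianProductWith⁺ position position-injective
        (support-unique β) (Unique.filter⁺ (nothing? ∘ lookup ℓ) (Unique.allFin⁺ _))
      nonempty : ∃[ x ] x ∈ˡ L′
      nonempty = _ , ∈ˡ.∈-cartesianProductWith⁺ position {xs = L} (here refl)
        (∈ˡ.∈-filter⁺ (nothing? ∘ lookup ℓ) (∈ˡ.∈-allFin (Anyᵛ.index active))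
          (Anyᵛ.lookup-index active))
      toNonempty : ∀ M → ∃[ x ] x ∈ˡ M → ∃[ γ ] toList γ ≡ M
      toNonempty (x ∷ M) _ = (x ∷ M) , refl
      β′ = proj₁ (toNonempty L′ nonempty)
      β′≡L′ = proj₂ (toNonempty L′ nonempty)
      ∑β′ : ∀ c → value (∑ β′ (fn c)) ≡ sumOver L′ (value ∘ fn c)
      ∑β′ c = trans (∑-unique β′ (subst Unique (sym β′≡L′) L′-unique) (fn c))
        (cong (λ M → sumOver M (value ∘ fn c)) β′≡L′)

-- Partition regularity of J-sets

Captures : Pred ℕ⁺ 0ℓ → 𝒫fℕ^ℕ → Set
Captures A F = ∃[ a ] ∃[ β ] (∀ {f} → f ∈ F → A (a + (∑[ t ∈ β ] f t)))

module _ (em : ∀ {ℓ} → ExcludedMiddle ℓ) where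

  -- The property of A ∪ B is applied to the functions of all words at once. Words are coloured by
  -- whether their point falls in A, and a monochromatic line collapses to one pair a′, β′ that
  -- works for every function in F.
  J-set-∪-captures : ∀ {A B} → J-set (A ∪ B) → ∀ F → Captures A F ⊎ Captures B F
  J-set-∪-captures {A} {B} J F@(f₀ ∷ fs) = inDimension (halesJewett K 2)
    where
    K = List.length fs
    inDimension : ∃[ n ] (∀ (C : Vec (Fin (ℕ.suc K)) (ℕ.suc n) → Fin 2) → MonochromaticLine C) →
                  Captures A F ⊎ Captures B F
    inDimension (n , hj) = onLine (J family)
     where
     open Block n
     Word = Vec (Fin (ℕ.suc K)) (ℕ.suc n)

     fn : Fin (ℕ.suc K) → ℕ⁺ → ℕ⁺
     fn = List.lookup (f₀ ∷ fs)

     decode : Fin (ℕ.suc K ℕ.^ ℕ.suc n) → Word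
     decode i = tabulate (finToFun i)

     family : 𝒫fℕ^ℕ
     family = wordFunction fn (Vec.replicate _ zero) ∷ List.map (wordFunction fn ∘ decode) (allFin _)

     ∈-family : ∀ w → wordFunction fn w ∈ family
     ∈-family w = there (Any.map⁺ (Any.map same (∈ˡ.∈-allFin (funToFin (lookup w)))))
       where
       same : ∀ {i} → funToFin (lookup w) ≡ i → wordFunction fn w ≗ wordFunction fn (decode i)
       same refl y = cong (λ w → wordFunction fn w y) (sym
         (trans (Vec.tabulate-cong (Fin.finToFun-funToFin (lookup w))) (Vec.tabulate∘lookup w)))

     onLine : Captures (A ∪ B) family → Captures A F ⊎ Captures B F
     onLine (a , β , ∈A∪B) = fromLine (hj colour)
       where
       point : Word → ℕ⁺
       point w = a + ∑ β (wordFunction fn w)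

       colour-by : ∀ {P : Set} → Dec P → Fin 2
       colour-by (yes _) = zero
       colour-by (no  _) = suc zero

       colour : Word → Fin 2
       colour w = colour-by (em {P = A (point w)})

       fromLine : MonochromaticLine colour → Captures A F ⊎ Captures B F
       fromLine (ℓ , active , mono) with collapse fn ℓ active a β
       ... | a′ , β′ , eq = decide refl
         where
         capture : ∀ {C} → (∀ c → C (point (ℓ ⟪ c ⟫))) → Captures C F
         capture {C} ∈C = a′ , β′ , λ {f} f∈ →
           subst C (trans (eq (Any.index f∈))
               (cong (a′ +_) (∑-cong β′ (λ t → sym (Any.lookup-index f∈ t)))))
             (∈C (Any.index f∈))

         inA : ∀ w → colour w ≡ zero → A (point w)
         inA w eq with em {P = A (point w)}
         ... | yes w∈A = w∈A
         inA w () | no _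

         inB : ∀ w → colour w ≡ suc zero → B (point w)
         inB w eq with em {P = A (point w)} | ∈A∪B (∈-family w)
         ... | no w∉A | inj₁ w∈A = ⊥-elim (w∉A w∈A)
         ... | no w∉A | inj₂ w∈B = w∈B
         inB w () | yes _ | _

         decide : ∀ {c} → colour (ℓ ⟪ zero ⟫) ≡ c → Captures A F ⊎ Captures B F
         decide {zero}     eq = inj₁ (capture {A} λ c → inA (ℓ ⟪ c ⟫) (trans (mono c zero) eq))
         decide {suc zero} eq = inj₂ (capture {B} λ c → inB (ℓ ⟪ c ⟫) (trans (mono c zero) eq))

  -- The captured side may vary with the family. If B fails at G, then A captures `F ⁺++⁺ G`, and so
  -- F, for every F.
  J-set-∪ : ∀ A B → J-set (A ∪ B) → J-set A ⊎ J-set B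
  J-set-∪ A B J with em {P = J-set A}
  ... | yes JA = inj₁ JA
  ... | no ¬JA = inj₂ JB
    where
    open Classical em
    JB : J-set B
    JB G = dne λ ¬B → ¬JA λ F → restrict {F} ¬B (J-set-∪-captures {A} {B} J (F ⁺++⁺ G))
      where
      restrict : ∀ {F} → ¬ Captures B G → Captures A (F ⁺++⁺ G) ⊎ Captures B (F ⁺++⁺ G) → Captures A F
      restrict {F} ¬B (inj₁ (a , β , ∈A)) = a , β , λ f∈ → ∈A (∈-++ˡ F G f∈)
      restrict {F} ¬B (inj₂ (a , β , ∈B)) = ⊥-elim (¬B (a , β , λ f∈ → ∈B (∈-++ʳ F G f∈)))

-- From chains of contributions to idempotents

-- The tensor product as nested quantifiers starting from the first coordinate, the order in which
-- chains are concatenated; `⨂` peels off the last coordinate instead.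
Large : ∀ {k} → Vector (Ultrafilter ℕ⁺) k → Pred (Vec ℕ⁺ k) 0ℓ → Set
Large {ℕ.zero}  p A = A []
Large {ℕ.suc k} p A = p zero ∋ λ x → Large (Vector.tail p) (λ xs → A (x ∷ xs))

Large-⊆ : ∀ {k} (p : Vector (Ultrafilter ℕ⁺) k) {A B} → A ⊆ B → Large p A → Large p B
Large-⊆ {ℕ.zero}  p A⊆B A∈ = A⊆B A∈
Large-⊆ {ℕ.suc k} p A⊆B = Ultrafilter.upward (p zero) (Large-⊆ (Vector.tail p) A⊆B)

Large-∷ʳ : ∀ {k} (p : Vector (Ultrafilter ℕ⁺) (ℕ.suc k)) A →
  Large (Vector.init p) (λ xs → Vector.last p ∋ λ y → A (xs ∷ʳ y)) ⇔ Large p A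
Large-∷ʳ {ℕ.zero}  p A = mk⇔ id id
Large-∷ʳ {ℕ.suc k} p A = mk⇔
  (Ultrafilter.upward (p zero) λ {x} → Equivalence.to (rest x))
  (Ultrafilter.upward (p zero) λ {x} → Equivalence.from (rest x))
  where
  rest = λ x → Large-∷ʳ (Vector.tail p) (λ xs → A (x ∷ xs))

⨂⇔Large : ∀ {k} (p : Vector (Ultrafilter ℕ⁺) (ℕ.suc k)) A → ⨂ p ∋ A ⇔ Large p A
⨂⇔Large {ℕ.zero}  p A = mk⇔ id id
⨂⇔Large {ℕ.suc k} p A = mk⇔
  (Equivalence.to (Large-∷ʳ p A) ∘ Equivalence.to init⇔)
  (Equivalence.from init⇔ ∘ Equivalence.from (Large-∷ʳ p A))
  where
  init⇔ = ⨂⇔Large (Vector.init p) (λ xs → Vector.last p ∋ λ y → A (xs ∷ʳ y))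

≤-sumOver : ∀ {X : Set} {L : List X} {h : X → ℕ.ℕ} {n} →
            Any (λ x → n ℕ.≤ h x) L → n ℕ.≤ sumOver L h
≤-sumOver (here n≤)  = ℕ.≤-trans n≤ (ℕ.m≤m+n _ _)
≤-sumOver (there n≤) = ℕ.≤-trans (≤-sumOver n≤) (ℕ.m≤n+m _ _)

⊊-larger : ∀ F → ∃[ G ] F ⊊ G
⊊-larger F = (g ∷ toList F) , there , λ G⊑F → g∉F (G⊑F (here λ _ → refl))
  where
  g : ℕ⁺ → ℕ⁺
  -- Exceeds every f in F at each argument; the argument 1 is enough to tell them apart.
  g t = 1⁺ +₀ sumOver (toList F) (λ f → value (f t))
  g∉F : ¬ (g ∈ F)
  g∉F g∈F = ℕ.1+n≰n (≤-sumOver (Any.map (λ g≗f → ℕ.≤-reflexive (cong value (g≗f 1⁺))) g∈F))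

⊑-⊊-trans : ∀ {F G H} → F ⊑ G → G ⊊ H → F ⊊ H
⊑-⊊-trans F⊑G (G⊑H , H⋢G) = (λ f∈ → G⊑H (F⊑G f∈)) , λ H⊑F → H⋢G (λ f∈ → F⊑G (H⊑F f∈))

⊊-trans : ∀ {F G H} → F ⊊ G → G ⊊ H → F ⊊ H
⊊-trans {F} {G} {H} (F⊑G , _) = ⊑-⊊-trans {F} {G} {H} (λ {f} → F⊑G {f})

Contribution : Set
Contribution = 𝒫fℕ^ℕ → (ℕ⁺ → ℕ⁺) → ℕ⁺

-- The top G is recorded because the next chain, in the same coordinate or the following one, must
-- start above it.
data Run (z : Contribution) : 𝒫fℕ^ℕ → 𝒫fℕ^ℕ → ℕ⁺ → Set where
  last : ∀ {F G f} → F ⊊ G → f ∈ G → Run z F G (z G f)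
  cons : ∀ {F G H f x} → F ⊊ G → f ∈ G → Run z G H x → Run z F H (z G f + x)

Reachable : Contribution → 𝒫fℕ^ℕ → Pred ℕ⁺ 0ℓ
Reachable z F x = ∃[ G ] Run z F G x

run-++ : ∀ {z F G H x y} → Run z F G x → Run z G H y → Run z F H (x + y)
run-++ (last F⊊G f∈) s = cons F⊊G f∈ s
run-++ {z} {F} {G} {H} {y = y} (cons {G = K} {f = f} {x = x} F⊊G f∈ r) s =
  subst (Run z F H) (sym (+-assoc⁺ (z K f) x y)) (cons {G = K} F⊊G f∈ (run-++ r s))

run-⊑ : ∀ {z F F′ G x} → F ⊑ F′ → Run z F′ G x → Run z F G x
run-⊑ {F = F} {F′} F⊑ (last {G = G} F⊊G f∈) = last (⊑-⊊-trans {F} {F′} {G} F⊑ F⊊G) f∈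
run-⊑ {F = F} {F′} F⊑ (cons {G = G} F⊊G f∈ r) = cons (⊑-⊊-trans {F} {F′} {G} F⊑ F⊊G) f∈ r

module FromContribution (em : ∀ {ℓ} → ExcludedMiddle ℓ)
                        (ac : ∀ {a ℓ₁ b ℓ₂} → AxiomOfChoice a ℓ₁ b ℓ₂)
                        (z : Contribution)
                        (z-affine : ∀ G → ∃[ a ] ∃[ β ] (∀ f → z G f ≡ a + ∑ β f)) where

  -- A chain of one link suffices: if G lies above F and the test family F′, every f in F′ may be
  -- picked from G, and the a and β of `z-affine G` serve them all.
  Reachable-J : ∀ F → J-set (Reachable z F)
  Reachable-J F F′ with ⊊-larger (F ⁺++⁺ F′)
  ... | G , ⊊G with z-affine G
  ...   | a , β , z≡ = a , β , λ {f} f∈ → subst (Reachable z F) (z≡ f)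
          (G , last (⊑-⊊-trans {F} {F ⁺++⁺ F′} {G} (λ {f} → ∈-++ˡ F F′ {f}) ⊊G)
                    (proj₁ ⊊G (∈-++ʳ F F′ f∈)))

  ¬J-set-∅ : ¬ J-set ∅
  ¬J-set-∅ J = let _ , _ , ∈∅ = J (id ∷ []) in ∈∅ (here λ _ → refl)

  reachableFilter : Filter ℕ⁺
  reachableFilter = record
    { _∋ᶠ_   = λ A → ∃[ F ] ¬ J-set (Reachable z F ∩ ∁ A)
    ; univ   = (id ∷ []) , λ J → ¬J-set-∅ (J-set-⊆ (Reachable z _ ∩ ∁ U) ∅ (λ (_ , ¬⊤) → ¬⊤ _) J)
    ; proper = λ (F , ¬J) → ¬J (J-set-⊆ (Reachable z F) (Reachable z F ∩ ∁ ∅)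
        (λ x∈ → x∈ , λ ()) (Reachable-J F))
    ; upward = λ {A} {B} A⊆B (F , ¬J) → F , λ J → ¬J (J-set-⊆
        (Reachable z F ∩ ∁ B) (Reachable z F ∩ ∁ A) (λ (x∈ , x∉B) → x∈ , λ x∈A → x∉B (A⊆B x∈A)) J)
    ; meet   = λ {A} {B} → meet A B
    }
    where
    meet : ∀ A B → ∃[ F ] ¬ J-set (Reachable z F ∩ ∁ A) → ∃[ F ] ¬ J-set (Reachable z F ∩ ∁ B) →
           ∃[ F ] ¬ J-set (Reachable z F ∩ ∁ (A ∩ B))
    meet A B (F , ¬JA) (G , ¬JB) = F ⁺++⁺ G , λ J → split
      (J-set-∪ em (Reachable z F ∩ ∁ A) (Reachable z G ∩ ∁ B) (J-set-⊆
        (Reachable z (F ⁺++⁺ G) ∩ ∁ (A ∩ B)) _ (λ {x} → cover {x}) J))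
      where
      cover : Reachable z (F ⁺++⁺ G) ∩ ∁ (A ∩ B) ⊆ (Reachable z F ∩ ∁ A) ∪ (Reachable z G ∩ ∁ B)
      cover {x} ((H , r) , x∉A∩B) with em {P = A x}
      ... | no  x∉A = inj₁ ((H , run-⊑ (λ {f} → ∈-++ˡ F G {f}) r) , x∉A)
      ... | yes x∈A = inj₂ ((H , run-⊑ (λ {f} → ∈-++ʳ F G {f}) r) , λ x∈B → x∉A∩B (x∈A , x∈B))
      split : ¬ (J-set (Reachable z F ∩ ∁ A) ⊎ J-set (Reachable z G ∩ ∁ B))
      split (inj₁ JA) = ¬JA JA
      split (inj₂ JB) = ¬JB JB

  Reachable∈ : ∀ F → reachableFilter ∋ᶠ Reachable z F
  Reachable∈ F = F , λ J → ¬J-set-∅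
    (J-set-⊆ (Reachable z F ∩ ∁ (Reachable z F)) ∅ (λ (x∈ , x∉) → x∉ x∈) J)

  -- If x is reached along a chain with top G, adding x maps `Reachable z G` into `Reachable z F`. A
  -- J-set translated by x is a J-set, x being absorbed into a; so G witnesses that `-x + A` is in
  -- the filter.
  reachableFilter≤⊕ : reachableFilter ≤ᶠ reachableFilter ⊕ᶠ reachableFilter
  reachableFilter≤⊕ {A} (F , ¬J) =
    Filter.upward reachableFilter (λ {x} → translate {x}) (Reachable∈ F)
    where
    translate : Reachable z F ⊆ (λ x → reachableFilter ∋ᶠ λ y → A (x + y))
    translate {x} (G , r) = G , λ J → ¬J λ F′ → shift (J F′)
      where
      shift : ∀ {F′} → Captures (Reachable z G ∩ ∁ (λ y → A (x + y))) F′ →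
              Captures (Reachable z F ∩ ∁ A) F′
      shift (a , β , ∈G) = x + a , β , λ {f} f∈ →
        let (H , s) , x+y∉A = ∈G f∈
            assoc = +-assoc⁺ x a (∑ β f)
        in (H , subst (Run z F H) (sym assoc) (run-++ r s)) , x+y∉A ∘ subst A assoc

  idempotent : ∃[ p ] (𝒥 p × Idempotent p) × (∀ F → p ∋ Reachable z F)
  idempotent = fromExtension
    (IdempotentExtension.idempotentExtension em ac reachableFilter
      (λ {A} → reachableFilter≤⊕ {A}))
    where
    fromExtension : (∃[ p ] reachableFilter ≤ᶠ ⌊ p ⌋ × Idempotent p) →
                    ∃[ p ] (𝒥 p × Idempotent p) × (∀ F → p ∋ Reachable z F)
    fromExtension (p , reachable≤p , p-idem) =
      p , ((λ {A} → p∈𝒥 {A}) , p-idem) , λ F → reachable≤p (Reachable∈ F)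
      where
      open Classical em
      module P = Ultrafilter p
      p∈𝒥 : 𝒥 p
      -- If A were not a J-set, its complement would be in the filter and hence in p.
      p∈𝒥 {A} A∈ = dne λ ¬JA → P.proper (P.upward (λ (x∈ , x∉) → x∉ x∈) (P.meet A∈
        (reachable≤p {∁ A} ((id ∷ []) , λ J → ¬JA
          (J-set-⊆ (Reachable z _ ∩ ∁ (∁ A)) A (λ (_ , x∉∁A) → dne x∉∁A) J)))))

-- Realising concatenated chains by one increasing sequence

suc⁺ : ℕ⁺ → ℕ⁺
suc⁺ (positive n) = positive (ℕ.suc n)

suc⁺-injective : ∀ {m n} → suc⁺ m ≡ suc⁺ n → m ≡ n
suc⁺-injective eq = value-injective (ℕ.suc-injective (cong value eq))

index : ℕ⁺ → ℕ.ℕ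
index i = ℕ.pred (value i)

suc-index : ∀ i → ℕ.suc (index i) ≡ value i
suc-index (positive (ℕ.suc n)) = refl

∑-∷ : ∀ x β → Unique (x ∷ toList β) → ∀ f → ∑ (x ∷⁺ β) f ≡ f x + ∑ β f
∑-∷ x β (x∉ ∷ u) f = value-injective (trans (∑-unique (x ∷⁺ β) (x∉ ∷ u) f)
  (cong (value (f x) ℕ.+_) (sym (∑-unique β u f))))

infix 4 _≪_

_≪_ : 𝒫fℕ → 𝒫fℕ → Set
β ≪ γ = ∀ {x y} → x ∈ˡ toList β → y ∈ˡ toList γ → value x ℕ.< value y

max-< : ∀ β {n} → (∀ {x} → x ∈ˡ toList β → value x ℕ.< n) → max β ℕ.< n
max-< (x ∷ xs) {n} = go x xs
  where
  go : ∀ x xs → (∀ {y} → y ∈ˡ x ∷ xs → value y ℕ.< n) → max (x ∷ xs) ℕ.< n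
  go x [] below = below (here refl)
  go x (y ∷ ys) below = ℕ.⊔-lub (below (here refl)) (go y ys (below ∘ there))

<-min : ∀ β {n} → (∀ {x} → x ∈ˡ toList β → n ℕ.< value x) → n ℕ.< min β
<-min (x ∷ xs) {n} = go x xs
  where
  go : ∀ x xs → (∀ {y} → y ∈ˡ x ∷ xs → n ℕ.< value y) → n ℕ.< min (x ∷ xs)
  go x [] above = above (here refl)
  go x (y ∷ ys) above = ℕ.⊓-glb (above (here refl)) (go y ys (above ∘ there))

≤-max : ∀ β {x} → x ∈ˡ toList β → value x ℕ.≤ max β
≤-max (x ∷ []) (here refl) = ℕ.≤-refl
≤-max (x ∷ y ∷ ys) (here refl) = ℕ.m≤m⊔n _ _
≤-max (x ∷ y ∷ ys) (there x∈) = ℕ.≤-trans (≤-max (y ∷ ys) x∈) (ℕ.m≤n⊔m _ _)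

min-≤ : ∀ β {x} → x ∈ˡ toList β → min β ℕ.≤ value x
min-≤ (x ∷ []) (here refl) = ℕ.≤-refl
min-≤ (x ∷ y ∷ ys) (here refl) = ℕ.m⊓n≤m _ _
min-≤ (x ∷ y ∷ ys) (there x∈) = ℕ.≤-trans (ℕ.m⊓n≤n _ _) (min-≤ (y ∷ ys) x∈)

≪⇒≺ : ∀ {β γ} → β ≪ γ → β ≺ γ
≪⇒≺ {β} {γ} β≪γ = <-min γ λ y∈ → max-< β λ x∈ → β≪γ x∈ y∈

≺⇒≪ : ∀ {β γ} → β ≺ γ → β ≪ γ
≺⇒≪ {β} {γ} β≺γ x∈ y∈ = ℕ.≤-<-trans (≤-max β x∈) (ℕ.<-≤-trans β≺γ (min-≤ γ y∈))

-- The input of (1)(b), indexed from 0, with F below it so that a link can be put in front. The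
-- `β j` list nothing twice, so that `∑` adds up the lists as they stand.
record Realisation {k} (z : Vector Contribution k) (F : 𝒫fℕ^ℕ) (xs : Vec ℕ⁺ k) : Set where
  field
    G          : ℕ.ℕ → 𝒫fℕ^ℕ
    f          : ℕ.ℕ → ℕ⁺ → ℕ⁺
    f∈G        : ∀ i → f i ∈ G i
    F⊊G₀       : F ⊊ G 0
    increasing : ∀ i → G i ⊊ G (ℕ.suc i)
    β          : Vector 𝒫fℕ k
    unique     : ∀ j → Unique (toList (β j))
    ordered    : ∀ {i j} → i Fin.< j → β i ≪ β j
    sums       : ∀ j → lookup xs j ≡ (∑[ i ∈ β j ] z j (G (index i)) (f (index i)))

prepend : {X : Set} → X → (ℕ.ℕ → X) → ℕ.ℕ → X
prepend x s ℕ.zero    = x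
prepend x s (ℕ.suc i) = s i

-- Each coordinate's chain starts above the top of the previous one, which is what will separate the
-- index sets.
data Runs : ∀ {k} → Vector Contribution k → 𝒫fℕ^ℕ → Vec ℕ⁺ k → Set where
  []  : ∀ {z : Vector Contribution 0} {F} → Runs z F []
  _∷_ : ∀ {k} {z : Vector Contribution (ℕ.suc k)} {F G x xs} →
        Run (z zero) F G x → Runs (Vector.tail z) G xs → Runs z F (x ∷ xs)

-- No sum is left to form, but the sequence of families must still continue forever.
empty : ∀ {z : Vector Contribution 0} F → Realisation z F []
empty F = record
  { G = G ; f = λ i → List⁺.head (G i) ; f∈G = λ i → here λ _ → refl
  ; F⊊G₀ = proj₂ (⊊-larger F) ; increasing = λ i → proj₂ (⊊-larger (G i))
  ; β = λ () ; unique = λ () ; ordered = λ { {()} } ; sums = λ () }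
  where
  G : ℕ.ℕ → 𝒫fℕ^ℕ
  G ℕ.zero    = proj₁ (⊊-larger F)
  G (ℕ.suc i) = proj₁ (⊊-larger (G i))

module _ {k} (z : Vector Contribution k) where

  -- The new first index stays outside every `β j`; `newRun` makes it a set of its own, `extendRun`
  -- adds it to the first set.
  shift : ∀ {F G f xs} → F ⊊ G → f ∈ G → Realisation z G xs → Realisation z F xs
  shift {F} {G₀} {f₀} F⊊G₀ f₀∈ R = record
    { G = prepend G₀ G ; f = prepend f₀ f
    ; f∈G = λ { ℕ.zero → f₀∈ ; (ℕ.suc i) → f∈G i }
    ; F⊊G₀ = F⊊G₀
    ; increasing = λ { ℕ.zero → G₀⊊G ; (ℕ.suc i) → increasing i }
    ; β = List⁺.map suc⁺ ∘ β
    ; unique = λ j → Unique.map⁺ suc⁺-injective (unique j)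
    ; ordered = ordered′
    ; sums = λ j → trans (sums j) (trans
        (∑-cong (β j) (λ i → cong (λ n → z j (prepend G₀ G n) (prepend f₀ f n)) (suc-index i)))
        (sym (∑-map (β j) (unique j) suc⁺ suc⁺-injective _)))
    }
    where
    open Realisation R renaming (F⊊G₀ to G₀⊊G)
    ordered′ : ∀ {i j} → i Fin.< j → List⁺.map suc⁺ (β i) ≪ List⁺.map suc⁺ (β j)
    ordered′ {i} {j} i<j x∈ y∈
      with ∈ˡ.∈-map⁻ suc⁺ {xs = toList (β i)} x∈ | ∈ˡ.∈-map⁻ suc⁺ {xs = toList (β j)} y∈
    ... | _ , x′∈ , refl | _ , y′∈ , refl = ℕ.s≤s (ordered {i} {j} i<j x′∈ y′∈)

1<suc⁺ : ∀ γ {y} → y ∈ˡ toList (List⁺.map suc⁺ γ) → 1 ℕ.< value y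
1<suc⁺ γ y∈ with ∈ˡ.∈-map⁻ suc⁺ {xs = toList γ} y∈
... | positive (ℕ.suc n) , _ , refl = ℕ.s≤s (ℕ.s≤s ℕ.z≤n)

module _ {k} (z : Vector Contribution (ℕ.suc k)) where

  newRun : ∀ {F G f xs} → F ⊊ G → f ∈ G → Realisation (Vector.tail z) G xs →
           Realisation z F (z zero G f ∷ xs)
  newRun {F} {G₀} {f₀} F⊊G₀ f₀∈ R = record
    { G = G ; f = f ; f∈G = f∈G ; F⊊G₀ = F⊊G₀ ; increasing = increasing
    ; β = List⁺.[ 1⁺ ] Vector.∷ β
    ; unique = λ { zero → [] ∷ [] ; (suc j) → unique j }
    ; ordered = λ
      { {zero}  {suc j} _ (here refl) y∈ → 1<suc⁺ (Realisation.β R j) y∈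
      ; {suc i} {suc j} i<j x∈ y∈ → ordered (ℕ.s<s⁻¹ i<j) x∈ y∈ }
    ; sums = λ { zero → refl ; (suc j) → sums j }
    }
    where open Realisation (shift (Vector.tail z) F⊊G₀ f₀∈ R) hiding (F⊊G₀)

  extendRun : ∀ {F G f x xs} → F ⊊ G → f ∈ G → Realisation z G (x ∷ xs) →
              Realisation z F (z zero G f + x ∷ xs)
  extendRun {F} {G₀} {f₀} F⊊G₀ f₀∈ R = record
    { G = G ; f = f ; f∈G = f∈G ; F⊊G₀ = F⊊G₀ ; increasing = increasing
    ; β = (1⁺ ∷⁺ β zero) Vector.∷ (β ∘ suc)
    ; unique = λ { zero → unique₀ ; (suc j) → unique (suc j) }
    ; ordered = λ
      { {zero}  {suc j} _ (here refl) y∈ → 1<suc⁺ (Realisation.β R (suc j)) y∈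
      ; {zero}  {suc j} 0<j (there x∈) y∈ → ordered {zero} {suc j} 0<j x∈ y∈
      ; {suc i} {suc j} i<j x∈ y∈ → ordered i<j x∈ y∈ }
    ; sums = λ
      { zero → trans (cong (z zero G₀ f₀ +_) (sums zero)) (sym (∑-∷ 1⁺ (β zero) unique₀ _))
      ; (suc j) → sums (suc j) }
    }
    where
    open Realisation (shift z F⊊G₀ f₀∈ R) hiding (F⊊G₀)
    unique₀ : Unique (1⁺ ∷ toList (β zero))
    unique₀ = All.tabulate (λ y∈ → ℕ.<⇒≢ (1<suc⁺ (Realisation.β R zero) y∈) ∘ cong value)
      ∷ unique zero

  realiseRun : ∀ {F G x xs} → Run (z zero) F G x → Realisation (Vector.tail z) G xs →
               Realisation z F (x ∷ xs)
  realiseRun (last F⊊G f∈) R = newRun F⊊G f∈ R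
  realiseRun (cons F⊊G f∈ r) R = extendRun F⊊G f∈ (realiseRun r R)

realise : ∀ {k} {z : Vector Contribution k} {F xs} → Runs z F xs → Realisation z F xs
realise {F = F} [] = empty F
realise {z = z} (r ∷ rs) = realiseRun z r (realise rs)

-- The top G of the first chain depends on its sum x, so the remaining coordinates are treated
-- separately above each such G.
Large-Runs : ∀ {k} (p : Vector (Ultrafilter ℕ⁺) k) (z : Vector Contribution k) →
  (∀ j F → p j ∋ Reachable (z j) F) → ∀ F → Large p (Runs z F)
Large-Runs {ℕ.zero}  p z ∈p F = []
Large-Runs {ℕ.suc k} p z ∈p F = Ultrafilter.upward (p zero)
  (λ {x} (G , r) → Large-⊆ (Vector.tail p) (λ {xs} → r ∷_)
    (Large-Runs (Vector.tail p) (Vector.tail z) (∈p ∘ suc) G))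
  (∈p zero F)

-- From idempotents to chains of contributions

-- The J-set property is applied to the functions t ↦ f (t + N); moving β up by N undoes the
-- translation.
J-set-above : ∀ {A} → J-set A → ∀ F N →
  ∃[ a ] ∃[ β ] N ℕ.< min β × (∀ {f} → f ∈ F → A (a + ∑ β f))
J-set-above {A} J F N = above (J (List⁺.map (_∘ (_+₀ N)) F))
  where
  +N-injective : ∀ {x y} → x +₀ N ≡ y +₀ N → x ≡ y
  +N-injective eq = value-injective (ℕ.+-cancelʳ-≡ N _ _ (cong value eq))
  N<+N : ∀ x → N ℕ.< value (x +₀ N)
  N<+N (positive (ℕ.suc n)) = ℕ.s≤s (ℕ.m≤n+m N n)
  above : ∃[ a ] ∃[ β ] (∀ {f} → f ∈ List⁺.map (_∘ (_+₀ N)) F → A (a + ∑ β f)) →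
          ∃[ a ] ∃[ β ] N ℕ.< min β × (∀ {f} → f ∈ F → A (a + ∑ β f))
  above (a , β , ∈A) = a , List⁺.map (_+₀ N) (removeRepeats β) , <-min _ N<β′ , λ {f} f∈ →
    subst (λ s → A (a + s))
      (sym (trans (∑-map (removeRepeats β) (support-unique β) (_+₀ N) +N-injective f)
                  (removeRepeats-∑ β (f ∘ (_+₀ N)))))
      (∈A (Any.map⁺ (Any.map (λ f≗g t → f≗g (t +₀ N)) f∈)))
    where
    N<β′ : ∀ {x} → x ∈ˡ List.map (_+₀ N) (support β) → N ℕ.< value x
    N<β′ x∈ with ∈ˡ.∈-map⁻ (_+₀ N) {xs = support β} x∈
    ... | x , _ , refl = N<+N x

module Star (p : Ultrafilter ℕ⁺) (p-idem : Idempotent p) where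
  open Ultrafilter p hiding (_∋_)

  _⋆ : Pred ℕ⁺ 0ℓ → Pred ℕ⁺ 0ℓ
  (B ⋆) x = B x × p ∋ λ y → B (x + y)

  ⋆-large : ∀ {B} → p ∋ B → p ∋ B ⋆
  ⋆-large {B} B∈ = meet B∈ (Equivalence.from (p-idem B) B∈)

  -- `-x + B` is in p, hence so is its own star, and the star commutes with translation.
  ⋆-translate : ∀ {B x} → (B ⋆) x → p ∋ λ y → (B ⋆) (x + y)
  ⋆-translate {B} {x} (_ , x∈) = upward
    (λ {y} (xy∈ , xy+∈) → xy∈ , upward (λ {z} → subst B (sym (+-assoc⁺ x y z))) xy+∈)
    (⋆-large {λ y → B (x + y)} x∈)

bounded-meet : ∀ (p : Ultrafilter ℕ⁺) {P : ℕ⁺ → Pred ℕ⁺ 0ℓ} → (∀ x → p ∋ P x) →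
  ∀ N → p ∋ λ z → ∀ x → value x ℕ.≤ N → P x z
bounded-meet p P∈ ℕ.zero = Ultrafilter.upward p
  (λ { _ (positive (ℕ.suc n)) () }) (ultrafilter-univ p)
bounded-meet p {P} P∈ (ℕ.suc N) = Ultrafilter.upward p
  (λ {z} (below , top) x x≤ → cases below top x (ℕ.m≤n⇒m<n∨m≡n x≤))
  (Ultrafilter.meet p (bounded-meet p P∈ N) (P∈ (positive (ℕ.suc N))))
  where
  cases : ∀ {z} → (∀ x → value x ℕ.≤ N → P x z) → P (positive (ℕ.suc N)) z →
          ∀ x → value x ℕ.< ℕ.suc N ⊎ value x ≡ ℕ.suc N → P x z
  cases below top x (inj₁ x<) = below x (ℕ.s≤s⁻¹ x<)
  cases {z} below top x (inj₂ x≡) = subst (λ x → P x z) (sym (value-injective x≡)) top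

-- The j-th coordinate may be increased by z, whatever the earlier coordinates
-- and the part of the j-th coordinate already summed, as long as these are
-- bounded by N.  Quantifying over all values up to N replaces the finite set of
-- sums formed so far.
module _ (em : ∀ {ℓ} → ExcludedMiddle ℓ) where

  Admissible : ∀ {k} (p : Vector (Ultrafilter ℕ⁺) k) → (∀ j → Idempotent (p j)) →
               Pred (Vec ℕ⁺ k) 0ℓ → ℕ.ℕ → Vector (Pred ℕ⁺ 0ℓ) k
  Admissible p idem A N zero z =
    Large p A → (B ⋆) z × (∀ y → value y ℕ.≤ N → (B ⋆) y → (B ⋆) (y + z))
    where
    open Star (p zero) (idem zero)
    B : Pred ℕ⁺ 0ℓ
    B x = Large (Vector.tail p) (λ xs → A (x ∷ xs))
  Admissible p idem A N (suc j) z = ∀ x → value x ℕ.≤ N →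
    Admissible (Vector.tail p) (idem ∘ suc) (λ xs → A (x ∷ xs)) N j z

  -- Whether Q holds is settled before p is consulted, so the constraints in `Admissible` are large
  -- even for values that violate their premises.
  implied : (p : Ultrafilter ℕ⁺) {Q : Set} {P : Pred ℕ⁺ 0ℓ} → (Q → p ∋ P) → p ∋ λ z → Q → P z
  implied p {Q} Q⇒P∈ with em {P = Q}
  ... | yes q = Ultrafilter.upward p (λ z∈ _ → z∈) (Q⇒P∈ q)
  ... | no ¬q = Ultrafilter.upward p (λ _ q → ⊥-elim (¬q q)) (ultrafilter-univ p)

  admissible : ∀ {k} (p : Vector (Ultrafilter ℕ⁺) k) idem A N j → p j ∋ Admissible p idem A N j
  admissible p idem A N zero = implied (p zero) λ A∈ →
    Ultrafilter.meet (p zero) (⋆-large A∈)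
      (bounded-meet (p zero) (λ y → implied (p zero) (⋆-translate {B} {y})) N)
    where
    open Star (p zero) (idem zero)
    B : Pred ℕ⁺ 0ℓ
    B x = Large (Vector.tail p) (λ xs → A (x ∷ xs))
  admissible p idem A N (suc j) = bounded-meet (p (suc j))
    (λ x → admissible (Vector.tail p) (idem ∘ suc) (λ xs → A (x ∷ xs)) N j) N

module _ (z : ℕ⁺ → ℕ⁺) (lo hi : ℕ⁺ → ℕ.ℕ)
         (hi≤lo : ∀ {i j} → value i ℕ.< value j → hi i ℕ.≤ lo j)
         (lo+z≤hi : ∀ i → lo i ℕ.+ value (z i) ℕ.≤ hi i) where

  z≤hi : ∀ i → value (z i) ℕ.≤ hi i
  z≤hi i = ℕ.≤-trans (ℕ.m≤n+m _ _) (lo+z≤hi i)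

  -- Invariant: the sum so far is at most `lo i` for every index i still to come. After adding `z i`
  -- it is at most `hi i`, hence at most `lo j` for each later j.
  sum-increasing : (S : Pred ℕ⁺ 0ℓ) → ∀ L → AllPairs (λ i j → value i ℕ.< value j) L →
    (∀ {i} → i ∈ˡ L → ∀ y → value y ℕ.≤ lo i → S y → S (y + z i)) →
    ∀ y → S y → All (λ i → value y ℕ.≤ lo i) L →
    ∃[ s ] value s ≡ value y ℕ.+ sumOver L (value ∘ z) × S s ×
           (∀ n → value y ℕ.≤ n → All (λ i → hi i ℕ.≤ n) L → value s ℕ.≤ n)
  sum-increasing S [] _ _ y y∈ _ = y , sym (ℕ.+-identityʳ _) , y∈ , λ n y≤n _ → y≤n
  sum-increasing S (i ∷ L) (i< ∷ L<) S-step y y∈ (y≤ ∷ _) =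
    s , trans s≡ (ℕ.+-assoc (value y) _ _) , s∈ ,
    λ { n y≤n (hi≤n ∷ L≤n) → bound n (ℕ.≤-trans y+z≤hi hi≤n) L≤n }
    where
    y+z≤hi = ℕ.≤-trans (ℕ.+-monoˡ-≤ (value (z i)) y≤) (lo+z≤hi i)
    rest = sum-increasing S L L< (S-step ∘ there) (y + z i) (S-step (here refl) y y≤ y∈)
      (All.map (λ i<j → ℕ.≤-trans y+z≤hi (hi≤lo i<j)) i<)
    s = proj₁ rest
    s≡ = proj₁ (proj₂ rest)
    s∈ = proj₁ (proj₂ (proj₂ rest))
    bound = proj₂ (proj₂ (proj₂ rest))

  open Sort (On.decTotalOrder ℕ.≤-decTotalOrder value) using (sort; sort-↭; sort-↗)

  sort-increasing : ∀ {L} → Unique L → AllPairs (λ i j → value i ℕ.< value j) (sort L)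
  sort-increasing {L} u = AllPairs.zipWith
    (λ (i≤j , i≢j) → ℕ.≤∧≢⇒< i≤j (i≢j ∘ value-injective))
    ( Linked⇒AllPairs ℕ.≤-trans (sort-↗ L)
    , ↭ₛ.Unique-resp-↭ (setoid ℕ⁺) (↭⇒↭ₛ (↭-sym (sort-↭ L))) u )

  -- Terms may be added only in increasing order of index, whereas β lists them in any order;
  -- sorting leaves the sum unchanged.
  ∑-closed : (S : Pred ℕ⁺ 0ℓ) → ∀ β → (∀ {i} → i ∈ˡ toList β → S (z i)) →
    (∀ {i} → i ∈ˡ toList β → ∀ y → value y ℕ.≤ lo i → S y → S (y + z i)) →
    S (∑ β z) × (∀ n → (∀ {i} → i ∈ˡ toList β → hi i ℕ.≤ n) → value (∑ β z) ℕ.≤ n)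
  ∑-closed S β S-start S-step =
    fromSorted (sort (support β)) (sort-↭ (support β)) (sort-increasing (support-unique β))
    where
    ∈β : ∀ {L j} → L ↭ support β → j ∈ˡ L → j ∈ˡ toList β
    ∈β perm j∈ = ∈-support β (↭.∈-resp-↭ perm j∈)

    fromSorted : ∀ L → L ↭ support β → AllPairs (λ i j → value i ℕ.< value j) L →
      S (∑ β z) × (∀ n → (∀ {i} → i ∈ˡ toList β → hi i ℕ.≤ n) → value (∑ β z) ℕ.≤ n)
    fromSorted [] perm _ with () ← ↭.∈-resp-↭ (↭-sym perm) (here refl)
    fromSorted (i ∷ L) perm (i< ∷ L<) with
      sum-increasing S L L< (λ j∈ → S-step (∈β perm (there j∈))) (z i) (S-start (∈β perm (here refl)))
        (All.map (λ i<j → ℕ.≤-trans (z≤hi i) (hi≤lo i<j)) i<)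
    ... | s , s≡ , s∈ , bound = subst S s≡∑ s∈ , λ n hi≤n → subst (λ s → value s ℕ.≤ n) s≡∑
            (bound n (ℕ.≤-trans (z≤hi i) (hi≤n (∈β perm (here refl)))) (All.tabulate (hi≤n ∘ ∈β perm ∘ there)))
      where
      s≡∑ : s ≡ ∑ β z
      s≡∑ = value-injective (trans s≡ (trans (sum-↭ (↭.map⁺ (value ∘ z) perm)) (sym (value-∑ β z))))

≪-trans : ∀ {α β γ} → α ≪ β → β ≪ γ → α ≪ γ
≪-trans α≪β β≪γ x∈ y∈ = ℕ.<-trans (α≪β x∈ (here refl)) (β≪γ (here refl) y∈)

≪-from-zero : ∀ {n} (β : Vector 𝒫fℕ (ℕ.suc n)) → (∀ j → β (inject₁ j) ≪ β (suc j)) →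
              ∀ j → β zero ≪ β (suc j)
≪-from-zero β β≪ zero = β≪ zero
≪-from-zero β β≪ (suc j) = ≪-trans {β zero} {β (suc zero)} {β (suc (suc j))}
  (β≪ zero) (≪-from-zero (Vector.tail β) (β≪ ∘ suc) j)

≪-consecutive : ∀ {n} (β : Vector 𝒫fℕ (ℕ.suc n)) → (∀ j → β (inject₁ j) ≪ β (suc j)) →
                ∀ {i j} → i Fin.< j → β i ≪ β j
≪-consecutive β β≪ {zero} {suc j} _ = ≪-from-zero β β≪ j
≪-consecutive {ℕ.suc n} β β≪ {suc i} {suc j} i<j =
  ≪-consecutive (Vector.tail β) (β≪ ∘ suc) (ℕ.s<s⁻¹ i<j)

module _ (em : ∀ {ℓ} → ExcludedMiddle ℓ) (lo hi : ℕ⁺ → ℕ.ℕ)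
         (hi≤lo : ∀ {i j} → value i ℕ.< value j → hi i ℕ.≤ lo j) where

  -- The first sum x lies in the star of B, so `Large` passes to the slice at x. As x is bounded by
  -- `hi` on `β zero`, it is within `lo` at all later indices, and the constraints on the other
  -- coordinates apply to it.
  admissible-sums : ∀ {k} (p : Vector (Ultrafilter ℕ⁺) k) idem A → Large p A →
    (z : Fin k → ℕ⁺ → ℕ⁺) → (∀ j i → lo i ℕ.+ value (z j i) ℕ.≤ hi i) →
    (β : Vector 𝒫fℕ k) → (∀ {i j} → i Fin.< j → β i ≪ β j) →
    (∀ j {i} → i ∈ˡ toList (β j) → Admissible em p idem A (lo i) j (z j i)) →
    A (tabulate λ j → ∑ (β j) (z j))
  admissible-sums {ℕ.zero} p idem A A∈ z _ β _ _ = A∈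
  admissible-sums {ℕ.suc k} p idem A A∈ z z≤ β β≪ adm =
    admissible-sums (Vector.tail p) (idem ∘ suc) (λ xs → A (x ∷ xs)) (proj₁ (proj₁ x∈))
      (z ∘ suc) (z≤ ∘ suc) (Vector.tail β) (λ i<j → β≪ (ℕ.s≤s i<j))
      (λ j {i} i∈ → adm (suc j) i∈ x (x≤lo j i∈))
    where
    open Star (p zero) (idem zero)
    B : Pred ℕ⁺ 0ℓ
    B x = Large (Vector.tail p) (λ xs → A (x ∷ xs))
    x = ∑ (β zero) (z zero)
    x∈ : (B ⋆) x × (∀ n → (∀ {i} → i ∈ˡ toList (β zero) → hi i ℕ.≤ n) → value x ℕ.≤ n)
    x∈ = ∑-closed (z zero) lo hi hi≤lo (z≤ zero) (B ⋆) (β zero)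
      (λ i∈ → proj₁ (adm zero i∈ A∈)) (λ i∈ → proj₂ (adm zero i∈ A∈))
    x≤lo : ∀ j {i} → i ∈ˡ toList (β (suc j)) → value x ℕ.≤ lo i
    x≤lo j i∈ = proj₂ x∈ _ λ i′∈ → hi≤lo (β≪ {zero} {suc j} (ℕ.s≤s ℕ.z≤n) i′∈ i∈)

-- Recursion along proper inclusion of finite sets

module _ (em : ∀ {ℓ} → ExcludedMiddle ℓ) where

  -- For G ⊑ F, this presents G by a sublist of F, one of finitely many.
  trace : 𝒫fℕ^ℕ → 𝒫fℕ^ℕ → List (ℕ⁺ → ℕ⁺)
  trace G F = filter (λ f → em {P = f ∈ G}) (toList F)

  ∈-resp-≗ : ∀ (G : 𝒫fℕ^ℕ) {f g} → f ≗ g → f ∈ G → g ∈ G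
  ∈-resp-≗ G = ∈ₛ.∈-resp-≈ ℕ^ℕ {toList G}

  trace-≋ : ∀ {G F} → G ⊑ F → ∃[ G′ ] toList G′ ≡ trace G F × G′ ≋ G
  trace-≋ {G} {F} G⊑F = nonempty (trace G F) refl
    where
    to : ∀ {f} → f ∈ G → Any (f ≗_) (trace G F)
    to f∈G = ∈ₛ.∈-filter⁺ ℕ^ℕ (λ f → em {P = f ∈ G}) (∈-resp-≗ G) (G⊑F f∈G) f∈G
    from : ∀ {f} → Any (f ≗_) (trace G F) → f ∈ G
    from f∈ = proj₂ (∈ₛ.∈-filter⁻ ℕ^ℕ (λ f → em {P = f ∈ G}) (∈-resp-≗ G) {xs = toList F} f∈)
    nonempty : ∀ L → L ≡ trace G F → ∃[ G′ ] toList G′ ≡ trace G F × G′ ≋ G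
    nonempty [] eq with () ← subst (Any (List⁺.head G ≗_)) (sym eq) (to (here λ _ → refl))
    nonempty (g ∷ L) eq = (g ∷ L) , eq ,
      (λ f∈ → from (subst (Any (_ ≗_)) eq f∈)) , (λ f∈ → subst (Any (_ ≗_)) (sym eq) (to f∈))

  trace-shorter : ∀ {G F} → G ⊊ F → List.length (trace G F) ℕ.< List.length (toList F)
  trace-shorter {G} {F} (_ , F⋢G) = List.filter-notAll (λ f → em {P = f ∈ G}) (toList F)
    (All.¬All⇒Any¬ (λ f → em {P = f ∈ G}) (toList F)
      λ all → F⋢G λ f∈F → let g∈G , f≗g = All.lookupAny all f∈F in ∈-resp-≗ G (sym ∘ f≗g) g∈G)

  -- Repetitions can make a proper subset longer than F as a list, so length decreases only for its
  -- trace. Accessibility passes back to G because `⊊` respects `≋`.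
  ⊊-wellFounded : WellFounded _⊊_
  ⊊-wellFounded F = go _ F ℕ.≤-refl
    where
    go : ∀ n F → List.length (toList F) ℕ.≤ n → Acc _⊊_ F
    go (ℕ.suc n) F F≤n = acc λ {G} G⊊F → below G⊊F (trace-≋ {G} {F} (proj₁ G⊊F))
      where
      below : ∀ {G} → G ⊊ F → (∃[ G′ ] toList G′ ≡ trace G F × G′ ≋ G) → Acc _⊊_ G
      below {G} G⊊F (G′ , eq , G′⊑G , G⊑G′) = acc λ {E} (E⊑G , G⋢E) →
        acc-inverse (go n G′ (ℕ.s≤s⁻¹ (ℕ.≤-trans
            (subst (λ L → List.length L ℕ.< _) (sym eq) (trace-shorter {G} {F} G⊊F)) F≤n)))
          ((λ f∈ → G⊑G′ (E⊑G f∈)) , λ G′⊑E → G⋢E λ f∈ → G′⊑E (G⊑G′ f∈))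

sublists : ∀ {X : Set} → List X → List (List X)
sublists []       = [] ∷ []
sublists (x ∷ xs) = List.map (x ∷_) (sublists xs) List.++ sublists xs

filter∈sublists : ∀ {X : Set} {P : Pred X 0ℓ} (P? : ∀ x → Dec (P x)) xs →
                  filter P? xs ∈ˡ sublists xs
filter∈sublists P? [] = here refl
filter∈sublists P? (x ∷ xs) with P? x
... | yes _ = ∈ˡ.∈-++⁺ˡ (∈ˡ.∈-map⁺ (x ∷_) (filter∈sublists P? xs))
... | no  _ = ∈ˡ.∈-++⁺ʳ _ (filter∈sublists P? xs)

wellFoundedFixpoint : ∀ {X Y : Set} {_<_ : Rel X 0ℓ} → WellFounded _<_ →
  (step : ∀ x → (∀ {y} → y < x → Y) → Y) →
  (∀ x {h h′ : ∀ {y} → y < x → Y} → (∀ {y} (y<x : y < x) → h {y} y<x ≡ h′ {y} y<x) →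
     step x (λ {y} → h {y}) ≡ step x (λ {y} → h′ {y})) →
  Σ[ h ∈ (X → Y) ] (∀ x → h x ≡ step x (λ {y} _ → h y))
wellFoundedFixpoint {Y = Y} wf step step-ext =
  WellFounded.All.wfRec wf 0ℓ (λ _ → Y) step ,
  λ x → FixPoint.unfold-wfRec wf (λ _ → Y) step step-ext {x}

chain-⊊ : (G : ℕ⁺ → 𝒫fℕ^ℕ) → (∀ i → G i ⊊ G (i + 1⁺)) →
          ∀ {i j} → value i ℕ.< value j → G i ⊊ G j
chain-⊊ G G⊊ {i} {positive (ℕ.suc n)} i<j = go n i<j
  where
  go : ∀ n → value i ℕ.< ℕ.suc n → G i ⊊ G (positive (ℕ.suc n))
  go ℕ.zero i<1 = ⊥-elim (ℕ.<⇒≱ i<1 (subst (1 ℕ.≤_) (suc-index i) (ℕ.s≤s ℕ.z≤n)))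
  go (ℕ.suc n) i<2+n = [ (λ i<1+n → ⊊-trans {G i} {G j} (go n i<1+n) next) ,
      (λ i≡j → subst (λ i → G i ⊊ G _) (sym (value-injective {i} {j} i≡j)) next)
    ]′ (ℕ.m≤n⇒m<n∨m≡n (ℕ.s≤s⁻¹ i<2+n))
    where
    j = positive (ℕ.suc n)
    next : G j ⊊ G (positive (2 ℕ.+ n))
    next = subst (λ i → G j ⊊ G i) (value-injective (ℕ.+-comm (value j) 1)) (G⊊ j)

-- The recursive choice of α and H

module Schedule (em : ∀ {ℓ} → ExcludedMiddle ℓ)
                (reps : Representatives 𝒫fℕ^ℕ-setoid)
                {k} (p : Vector (Ultrafilter ℕ⁺) k)
                (p∈𝒥 : ∀ j → 𝒥 (p j)) (idem : ∀ j → Idempotent (p j))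
                (A : Pred (Vec ℕ⁺ k) 0ℓ) where

  record Step (lo : ℕ.ℕ) (F : 𝒫fℕ^ℕ) : Set where
    field
      α        : Fin k → ℕ⁺
      H        : Fin k → 𝒫fℕ
      hi       : ℕ.ℕ
      lo<min   : ∀ j → lo ℕ.< min (H j)
      max≤hi   : ∀ j → max (H j) ℕ.≤ hi
      allowed  : ∀ j {f} → f ∈ F → Admissible em p idem A lo j (α j + ∑ (H j) f)
      lo+sum≤hi : ∀ j {f} → f ∈ F → lo ℕ.+ value (α j + ∑ (H j) f) ℕ.≤ hi

  step : ∀ lo F → Step lo F
  step lo F = record
    { α = α ; H = H ; hi = lo ℕ.+ sumOver (allFin k) cost
    ; lo<min = λ j → proj₁ (proj₂ (proj₂ (choice j)))
    ; max≤hi = λ j → ℕ.≤-trans (ℕ.m≤m+n _ _) (ℕ.≤-trans (cost≤ j) (ℕ.m≤n+m _ lo))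
    ; allowed = λ j → proj₂ (proj₂ (proj₂ (choice j)))
    ; lo+sum≤hi = λ j f∈ → ℕ.+-monoʳ-≤ lo (ℕ.≤-trans
        (≤-sumOver (Any.map (λ f≗g → ℕ.≤-reflexive
          (cong (λ s → value (α j + s)) (∑-cong (H j) f≗g))) f∈))
        (ℕ.≤-trans (ℕ.m≤n+m _ (max (H j))) (cost≤ j)))
    }
    where
    choice : ∀ j → ∃[ a ] ∃[ β ] lo ℕ.< min β ×
             (∀ {f} → f ∈ F → Admissible em p idem A lo j (a + ∑ β f))
    choice j = J-set-above {Admissible em p idem A lo j}
      (p∈𝒥 j {Admissible em p idem A lo j} (admissible em p idem A lo j)) F lo
    α = λ j → proj₁ (choice j)
    H = λ j → proj₁ (proj₂ (choice j))
    -- Adding up all the quantities to be bounded gives an upper bound for each.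
    cost : Fin k → ℕ.ℕ
    cost j = max (H j) ℕ.+ sumOver (toList F) (λ f → value (α j + ∑ (H j) f))
    cost≤ : ∀ j → cost j ℕ.≤ sumOver (allFin k) cost
    cost≤ j = ≤-sumOver {h = cost} (Any.map (λ eq → ℕ.≤-reflexive (cong cost eq)) (∈ˡ.∈-allFin j))

  -- Recursion along ⊊ meets each proper subset of F in infinitely many
  -- presentations, so it is restricted to canonical ones.
  open Representatives reps

  whenTrue : {P : Set} → Dec P → (P → ℕ.ℕ) → ℕ.ℕ
  whenTrue (yes q) h = h q
  whenTrue (no  _) h = 0

  whenTrue-cong : {P : Set} (d : Dec P) {h h′ : P → ℕ.ℕ} → h ≗ h′ → whenTrue d h ≡ whenTrue d h′
  whenTrue-cong (yes q) h≗h′ = h≗h′ q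
  whenTrue-cong (no  _) h≗h′ = refl

  whenTrue-≤ : {P : Set} (d : Dec P) (n : ℕ.ℕ) → P → n ℕ.≤ whenTrue d (λ _ → n)
  whenTrue-≤ (yes _) n q = ℕ.≤-refl
  whenTrue-≤ (no ¬q) n q = ⊥-elim (¬q q)

  -- The test supplies the proof of `⊊` that h requires and discards sublists that present all of F;
  -- the default 0 is neutral in the sum forming `lo`.
  bound : ∀ F → (∀ {G} → G ⊊ F → ℕ.ℕ) → List (ℕ⁺ → ℕ⁺) → ℕ.ℕ
  bound F h []      = 0
  bound F h (g ∷ G) = whenTrue (em {P = rep (g ∷ G) ⊊ F}) h

  bound-cong : ∀ F {h h′ : ∀ {G} → G ⊊ F → ℕ.ℕ} →
    (∀ {G} (G⊊F : G ⊊ F) → h {G} G⊊F ≡ h′ {G} G⊊F) →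
    bound F (λ {G} → h {G}) ≗ bound F (λ {G} → h′ {G})
  bound-cong F h≡h′ []      = refl
  bound-cong F h≡h′ (g ∷ G) = whenTrue-cong em h≡h′

  hiRec : ∀ F → (∀ {G} → G ⊊ F → ℕ.ℕ) → ℕ.ℕ
  hiRec F h = Step.hi (step (sumOver (sublists (toList F)) (bound F (λ {G} → h {G}))) F)

  hiRec-ext : ∀ F {h h′ : ∀ {G} → G ⊊ F → ℕ.ℕ} →
    (∀ {G} (G⊊F : G ⊊ F) → h {G} G⊊F ≡ h′ {G} G⊊F) →
    hiRec F (λ {G} → h {G}) ≡ hiRec F (λ {G} → h′ {G})
  hiRec-ext F {h} {h′} h≡h′ = cong (λ lo → Step.hi (step lo F))
    (sumOver-cong (sublists (toList F)) (bound-cong F {h} {h′} h≡h′))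

  Bounds : Set
  Bounds = Σ[ hi ∈ (𝒫fℕ^ℕ → ℕ.ℕ) ] (∀ F → hi F ≡ hiRec F (λ {G} _ → hi G))

  bounds : Bounds
  bounds = wellFoundedFixpoint (⊊-wellFounded em) hiRec hiRec-ext

  module _ (bounds : Bounds) where

    open Σ bounds renaming (proj₁ to hi; proj₂ to hi-unfold)

    lo : 𝒫fℕ^ℕ → ℕ.ℕ
    lo F = sumOver (sublists (toList F)) (bound F (λ {G} _ → hi G))

    stepAt : ∀ F → Step (lo F) F
    stepAt F = step (lo F) F

    -- The trace of `rep F` on G is a sublist of G with canonical form `rep F`, so `hi (rep F)` is a
    -- summand of `lo G`.
    hi≤lo : ∀ {F G} → rep F ⊊ G → hi (rep F) ℕ.≤ lo G
    hi≤lo {F} {G} F⊊G = viaTrace (trace-≋ em {rep F} {G} (proj₁ F⊊G))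
      where
      viaTrace : (∃[ F′ ] toList F′ ≡ trace em (rep F) G × F′ ≋ rep F) → hi (rep F) ℕ.≤ lo G
      viaTrace (F′ , eq , F′≋) =
        ≤-sumOver (Any.map at (subst (_∈ˡ sublists (toList G)) (sym eq)
          (filter∈sublists (λ f → em {P = f ∈ rep F}) (toList G))))
        where
        rep-F′ : rep F′ ≡ rep F
        rep-F′ = rep-cong {F′} {F} (Setoid.trans 𝒫fℕ^ℕ-setoid {F′} {rep F} {F} F′≋ (rep-≈ F))
        at : ∀ {L} → toList F′ ≡ L → hi (rep F) ℕ.≤ bound G (λ {G} _ → hi G) L
        at refl = subst (λ R → hi R ℕ.≤ whenTrue (em {P = rep F′ ⊊ G}) (λ _ → hi (rep F′))) rep-F′
          (whenTrue-≤ (em {P = rep F′ ⊊ G}) (hi (rep F′)) (subst (_⊊ G) (sym rep-F′) F⊊G))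

    rep-⊊ : ∀ {F G} → F ⊊ G → rep F ⊊ rep G
    rep-⊊ {F} {G} (F⊑G , G⋢F) =
      (λ f∈ → proj₂ (rep-≈ G) (F⊑G (proj₁ (rep-≈ F) f∈))) ,
      λ G⊑F → G⋢F λ f∈ → proj₁ (rep-≈ F) (G⊑F (proj₂ (rep-≈ G) f∈))

    α : Vector (Func 𝒫fℕ^ℕ-setoid ℕ⁺-setoid) k
    α j = record
      -- Evaluation at `rep F` makes the choice depend on the set alone.
      { to   = λ F → Step.α (stepAt (rep F)) j
      ; cong = λ {F} {G} F≋G → cong (λ F → Step.α (stepAt F) j) (rep-cong {F} {G} F≋G)
      }

    H : Vector (Func 𝒫fℕ^ℕ-setoid 𝒫fℕ-setoid) k
    H j = record
      { to   = λ F → Step.H (stepAt (rep F)) j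
      ; cong = λ {F} {G} F≋G → Setoid.reflexive 𝒫fℕ-setoid
          (cong (λ F → Step.H (stepAt F) j) (rep-cong {F} {G} F≋G))
      }

    lo′ hi′ : 𝒫fℕ^ℕ → ℕ.ℕ
    lo′ F = lo (rep F)
    hi′ F = Step.hi (stepAt (rep F))

    hi′≤lo′ : ∀ {F G} → F ⊊ G → hi′ F ℕ.≤ lo′ G
    hi′≤lo′ {F} {G} F⊊G = ℕ.≤-trans (ℕ.≤-reflexive (sym (hi-unfold (rep F))))
      (hi≤lo {F} {rep G} (rep-⊊ {F} {G} F⊊G))

    H-increasing : ∀ F G → F ⊊ G → ∀ j → (H j ⟨$⟩ F) ≺ (H j ⟨$⟩ G)
    H-increasing F G F⊊G j = ℕ.≤-<-trans (Step.max≤hi (stepAt (rep F)) j)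
      (ℕ.≤-<-trans (hi′≤lo′ {F} {G} F⊊G) (Step.lo<min (stepAt (rep G)) j))

    sums∈A : Large p A → (G : ℕ⁺ → 𝒫fℕ^ℕ) → (∀ i → G i ⊊ G (i + 1⁺)) →
      (β : Vector 𝒫fℕ k) → (∀ {i j} → i Fin.< j → β i ≪ β j) →
      (f : ℕ⁺ → ℕ⁺ → ℕ⁺) → (∀ i → f i ∈ G i) →
      A (tabulate λ j → ∑[ i ∈ β j ] ((α j ⟨$⟩ G i) + (∑[ t ∈ H j ⟨$⟩ G i ] f i t)))
    sums∈A A∈ G G⊊ β β≪ f f∈ = admissible-sums em (lo′ ∘ G) (hi′ ∘ G)
      (λ {i} {j} i<j → hi′≤lo′ {G i} {G j} (chain-⊊ G G⊊ {i} {j} i<j)) p idem A A∈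
      (λ j i → (α j ⟨$⟩ G i) + ∑ (H j ⟨$⟩ G i) (f i))
      (λ j i → Step.lo+sum≤hi (stepAt (rep (G i))) j (proj₂ (rep-≈ (G i)) (f∈ i)))
      β β≪ (λ j {i} _ → Step.allowed (stepAt (rep (G i))) j (proj₂ (rep-≈ (G i)) (f∈ i)))

corollary1p26 : (∀ {ℓ} → ExcludedMiddle ℓ) →
    (∀ {a ℓ₁ b ℓ₂} → AxiomOfChoice a ℓ₁ b ℓ₂) →
    (n : ℕ) → let m = 1+ n in
    (A : Pred (Vec ℕ⁺ m) 0ℓ) →
    (Σ[ α ∈ Vector (Func 𝒫fℕ^ℕ-setoid ℕ⁺-setoid) m ]
    Σ[ H ∈ Vector (Func 𝒫fℕ^ℕ-setoid 𝒫fℕ-setoid) m ]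
    ((F G : 𝒫fℕ^ℕ) → F ⊊ G →
    (j : Fin m) → (H j ⟨$⟩ F) ≺ (H j ⟨$⟩ G))
    ×
    ((G : ℕ⁺ → 𝒫fℕ^ℕ) → (∀ i → G i ⊊ G (i + 1⁺)) →
    (β : Vector 𝒫fℕ m) →
    (∀ (j : Fin n) → β (inject₁ j) ≺ β (suc j)) →
    (f : ℕ⁺ → ℕ⁺ → ℕ⁺) → (∀ i → f i ∈ G i) →
    A (tabulate λ j →
    ∑[ i ∈ β j ] ((α j ⟨$⟩ G i) + (∑[ t ∈ H j ⟨$⟩ G i ] f i t)))))
    ⇔
    (Σ[ p ∈ Vector (Ultrafilter ℕ⁺) m ]
    (∀ j → 𝒥 (p j) × Idempotent (p j)) × ⨂ p ∋ A)
corollary1p26 em ac n A = mk⇔ toUltrafilters fromUltrafilters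
  where
  toUltrafilters : _ → _
  toUltrafilters (α , H , _ , sums∈A) =
    p , (λ j → proj₁ (proj₂ (idempotents j))) ,
    Equivalence.from (⨂⇔Large p A)
      (Large-⊆ p {Runs z List⁺.[ id ]} {A} (λ {xs} rs → inA (realise rs))
        -- The chains need some family to start above; `[ id ]` is an arbitrary one.
        (Large-Runs p z (λ j → proj₂ (proj₂ (idempotents j))) (List⁺.[ id ])))
    where
    z : Vector Contribution (1+ n)
    z j G f = (α j ⟨$⟩ G) + ∑ (H j ⟨$⟩ G) f
    idempotents : ∀ j → ∃[ p ] (𝒥 p × Idempotent p) × (∀ F → p ∋ Reachable (z j) F)
    idempotents j = FromContribution.idempotent em ac (z j)
      (λ G → (α j ⟨$⟩ G) , (H j ⟨$⟩ G) , λ _ → refl)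
    p : Vector (Ultrafilter ℕ⁺) (1+ n)
    p j = proj₁ (idempotents j)
    inA : ∀ {F xs} → Realisation z F xs → A xs
    inA {xs = xs} R = subst A
      (trans (sym (Vec.tabulate-cong sums)) (Vec.tabulate∘lookup xs))
      (sums∈A (G ∘ index)
        (λ i → subst (λ k → G (index i) ⊊ G k) (index-+1⁺ i) (increasing (index i)))
        β (λ j → ≪⇒≺ {β (inject₁ j)} {β (suc j)}
            (ordered (ℕ.s≤s (ℕ.≤-reflexive (Fin.toℕ-inject₁ j)))))
        (f ∘ index) (f∈G ∘ index))
      where
      open Realisation R
      index-+1⁺ : ∀ i → ℕ.suc (index i) ≡ index (i + 1⁺)
      index-+1⁺ i = trans (suc-index i) (cong ℕ.pred (ℕ.+-comm 1 (value i)))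

  fromUltrafilters : _ → _
  fromUltrafilters (p , p∈ , A∈) = α bounds , H bounds , H-increasing bounds , λ G G⊊ β β≺ →
    sums∈A bounds (Equivalence.to (⨂⇔Large p A) A∈) G G⊊ β
      (≪-consecutive β (λ j → ≺⇒≪ {β (inject₁ j)} {β (suc j)} (β≺ j)))
    where
    open Schedule em (representatives ac 𝒫fℕ^ℕ-setoid) p
      (λ j {B} → proj₁ (p∈ j) {B}) (λ j → proj₂ (p∈ j)) A
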